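{- Let $\mathcal R = (\Sigma, E, R)$ be a rewrite theory and let $\Gamma_{\mathcal M}$ be the set of finite and infinite executions of the transition system $\mathcal M = (T_{\Sigma/E}, \to^1_R)$. For any $\infty$-recursively enumerable language $L \subseteq \Gamma_{\mathcal M}$, there is some strategy expression $\alpha$ such that $E(\alpha) = L$.
   Context: **Executions and languages.** An execution of $\mathcal M$ is a nonempty finite word $s_0\cdots s_n$ or an infinite word $s_0s_1\cdots$ of states with $s_k\to^1_R s_{k+1}$ for all consecutive states (any starting state). A language of finite and infinite words over a finite alphabet $A$ (here $A\subseteq T_{\Sigma/E}$ finite) is $\infty$-recursively enumerable if its finite words form a recursively enumerable language and its infinite words form an $\omega$-recursively enumerable language, i.e. the language accepted by a nondeterministic Turing machine with a Büchi condition: with input $w\in A^\omega$ written on its one-way infinite tape, $w$ is accepted if there is an infinite run that is complete (every tape position is visited at some time) and visits states of a given set $F$ infinitely often. **Strategy expression.** The expression $\alpha$ may call (recursive) strategies defined in a strategy module, which may rely on auxiliary equationally defined data types in a protecting extension of $(\Sigma,E)$ that changes neither the terms in $T_\Sigma$ nor their rewriting. **Rewriting.** $\mathcal R = (\Sigma, E, R)$ is a rewrite theory over a membership equational theory $(\Sigma,E)$, with labeled rules, possibly conditional, with condition fragments that are equations, sort memberships, or rewriting conditions $l \Rightarrow p$. Terms are considered modulo $E$; $T_\Sigma$ denotes ground terms and $T_{\Sigma/E}$ their classes modulo $E$ (brackets are omitted). $t \to^1_R t'$ is one-step rewriting. **Strategy expressions.** Core grammar: $\alpha ::= \mathtt{idle}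 \mid \mathtt{fail} \mid \mathtt{match}\,P\,\mathtt{s.t.}\,C \mid \alpha;\alpha \mid \alpha|\alpha \mid \alpha^* \mid \alpha\,?\,\alpha:\alpha \mid \mathtt{matchrew}\,P\,\mathtt{s.t.}\,C\,\mathtt{by}\,x_1\,\mathtt{using}\,\alpha_1,\ldots,x_n\,\mathtt{using}\,\alpha_n \mid sl(t_1,\ldots,t_n) \mid \mathtt{all} \mid rl[\rho]\{\alpha_1,\ldots,\alpha_m\}$, where $C$ is an equational condition, $rl$ is a rule label, $\rho$ is an optional initial substitution $x_1 \leftarrow t_1,\ldots$, the list of $m\ge0$ strategies is for a rule with $m$ rewriting conditions, and $sl$ is a strategy name given by definitions $sl(p_1,\ldots,p_n) := \delta$ (optionally: if an equational condition holds), which may be mutually recursive. Rule applications may be wrapped in $\mathtt{top}(\cdot)$ to apply only at the root. (Variants $\mathtt{amatch}$, $\mathtt{amatchrew}$ match at any position; $\mathtt{xmatch}$, $\mathtt{xmatchrew}$ match with extension.) Other combinators are abbreviations. **Execution states** $\mathcal{XS}$: $q ::= t \mathbin{@} s \mid \mathrm{subterm}(x_1:q_1,\ldots,x_n:q_n;t)\mathbin{@} s \mid \mathrm{rewc}(p:q,\sigma,C,\vec\alpha,\theta,r,c;t)\mathbin{@} s$, with stacks $s ::= \varepsilon \mid \alpha s \mid \theta s$ of strategy expressions $\alpha$ and substitutions $\theta$. $\mathrm{vctx}(\theta s)=\theta$, $\mathrm{vctx}(\varepsilon)=\mathrm{id}$, $\mathrm{vctx}(\alpha s)=\mathrm{vctx}(s)$.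 Current term: $\mathrm{cterm}(t\mathbin{@} s)=t$, $\mathrm{cterm}(\mathrm{rewc}(\ldots;t)\mathbin{@} s)=t$, $\mathrm{cterm}(\mathrm{subterm}(x_1:q_1,\ldots,x_n:q_n;t)\mathbin{@} s)=t[x_1/\mathrm{cterm}(q_1),\ldots,x_n/\mathrm{cterm}(q_n)]$. States $t\mathbin{@}\varepsilon$ are solutions. **Transitions** ($\to_c$ control, $\to_s$ system, $\to_{s,c} = \to_s\cup\to_c$), where $\theta=\mathrm{vctx}(s)$ instantiates the variables of the expressions: - $t\mathbin{@}\mathtt{idle}\,s\to_c t\mathbin{@} s$; no rule for $\mathtt{fail}$; $t\mathbin{@}\theta' s\to_c t\mathbin{@} s$ (popping a substitution). - $t\mathbin{@}(\mathtt{match}\,P\,\mathtt{s.t.}\,C)\,s\to_c t\mathbin{@} s$ if $t$ matches $P$ satisfying $C$. - $t\mathbin{@}(\alpha;\beta)s\to_c t\mathbin{@}\alpha\beta s$; $t\mathbin{@}(\alpha|\beta)s\to_c t\mathbin{@}\alpha s$ and $\to_c t\mathbin{@}\beta s$; $t\mathbin{@}\alpha^* s\to_c t\mathbin{@} s$ and $\to_c t\mathbin{@}\alpha\,\alpha^* s$. - $t\mathbin{@}(\alpha?\beta:\gamma)s\to_c t\mathbin{@}\alpha\beta s$; and $t\mathbin{@}(\alpha?\beta:\gamma)s\to_c t\mathbin{@}\gamma s$ if $\to_{s,c}$ is terminating from $t\mathbin{@}\alpha\theta$ and reaches no solution from it. - $t\mathbin{@}\mathtt{all}\,s\to_s t'\mathbin{@}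 s$ if $t\to^1_R t'$. For a rule labeled $rl$ without rewriting conditions, $t\mathbin{@} rl[\rho]s\to_s t'\mathbin{@} s$ for each $t'$ obtained from $t$ by applying, at some position, that rule instantiated first by $\rho$ (whose terms are instantiated by $\theta$). - For a rule labeled $rl$ with right-hand side $r$ and condition $C_0\wedge l_1\Rightarrow p_1\wedge C'$ with $C_0$ equational and $m\ge1$ rewriting fragments in total: $t\mathbin{@} rl[\rho]\{\alpha_1,\ldots,\alpha_m\}s\to_c\mathrm{rewc}(p_1:\sigma(l_1)\mathbin{@}\alpha_1\theta,\sigma,C',\alpha_2\cdots\alpha_m,\theta,r,c;t)\mathbin{@} s$ for each context $c$ and substitution $\sigma$ (extending $\rho$) matching the left-hand side in $t$ and satisfying $C_0$. If $q\to_s q'$ or $q\to_c q'$, then $\mathrm{rewc}(p:q,\ldots)\mathbin{@} s\to_c\mathrm{rewc}(p:q',\ldots)\mathbin{@} s$. For each $\sigma'$ extending $\sigma$ with $\sigma'(p)=t'$ and satisfying the equational condition $C_0$: $\mathrm{rewc}(p:t'\mathbin{@}\varepsilon,\sigma,C_0\wedge l\Rightarrow p'\wedge C,\alpha\vec\alpha,\theta,r,c;t)\mathbin{@} s\to_c\mathrm{rewc}(p':\sigma'(l)\mathbin{@}\alpha\theta,\sigma',C,\vec\alpha,\theta,r,c;t)\mathbin{@} s$, and, when no rewriting fragment remains, $\mathrm{rewc}(p:t'\mathbin{@}\varepsilon,\sigma,C_0,\ldots,r,c;t)\mathbin{@} s\to_s c(\sigma'(r))\mathbin{@} s$. - $t\mathbin{@}(\mathtt{matchrew}\,P\,\mathtt{s.t.}\,C\,\mathtt{by}\,x_1\,\mathtt{using}\,\alpha_1,\ldots)s\to_c\mathrm{subterm}(x_1:\sigma(x_1)\mathbin{@}\alpha_1\sigma,\ldots,x_n:\sigma(x_n)\mathbin{@}\alpha_n\sigma;\sigma_{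 -\{x_1,\ldots,x_n\}}(P))\mathbin{@} s$ for each match $\sigma$ of $t$ with $P$ satisfying $C$ and extending $\theta$ ($\sigma_{ -X}$ leaves the variables in $X$ untouched). If $q_i\to_\bullet q_i'$ with $\bullet\in\{s,c\}$, then $\mathrm{subterm}(\ldots,x_i:q_i,\ldots;t)\mathbin{@} s\to_\bullet\mathrm{subterm}(\ldots,x_i:q_i',\ldots;t)\mathbin{@} s$. $\mathrm{subterm}(x_1:t_1\mathbin{@}\varepsilon,\ldots,x_n:t_n\mathbin{@}\varepsilon;t)\mathbin{@} s\to_c t[x_1/t_1,\ldots,x_n/t_n]\mathbin{@} s$. - $t\mathbin{@} sl(t_1,\ldots,t_n)s\to_c t\mathbin{@}\delta\sigma s$ for every definition whose left-hand side matches the call instantiated by $\theta$, with substitution $\sigma$ (and condition satisfied), $\delta$ being its right-hand side; if the top of $s$ is a substitution, it is replaced by $\sigma$ (tail call). **Denotation.** $\twoheadrightarrow$ is $\to_c^*$ followed by one $\to_s$. $\mathrm{Ex}^*(\alpha,t)=\{q_0\cdots q_n: q_0=t\mathbin{@}\alpha,\ q_k\twoheadrightarrow q_{k+1},\ q_n\to_c^* t'\mathbin{@}\varepsilon \text{ for some } t'\in T_\Sigma\}$, $\mathrm{Ex}^\omega(\alpha,t)=\{(q_k)_{k\ge0}: q_0=t\mathbin{@}\alpha,\ q_k\twoheadrightarrow q_{k+1}\}$, $E(\alpha,t)=\mathrm{cterm}(\mathrm{Ex}^*(\alpha,t)\cup\mathrm{Ex}^\omega(\alpha,t))$ (cterm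 applied letterwise), and $E(\alpha)=\bigcup_{t\in T_\Sigma}E(\alpha,t)$. -}

module Defs where

open import Data.Fin using (Fin)
open import Data.Fin.Subset using (Subset) renaming (_∈_ to _∈ˢ_)
open import Data.List using (List; []; _∷_; _++_; map; length) renaming (lookup to lookupᴸ)
open import Data.List.Membership.Propositional using (_∈_)
open import Data.List.Membership.Propositional.Properties using (∈-map⁺; ∈-++⁺ˡ)
open import Data.List.Relation.Binary.Pointwise using (Pointwise)
open import Data.List.Relation.Unary.All as All using (All; []; _∷_; lookup; tabulate; _[_]≔_)
open import Data.List.Relation.Unary.All.Properties using (++⁺; map⁺)
open import Data.List.Relation.Unary.Linked using (Linked)
open import Data.List.Relation.Unary.Any using (here; there)
open import Data.Maybe as Maybe using (Maybe; just)
open import Data.Nat using (ℕ; zero; suc; _≤_)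
open import Data.Product using (∃; Σ-syntax; ∃-syntax; _×_; _,_)
open import Data.Sum using (_⊎_; inj₁; inj₂; [_,_]′)
open import Function using (_∘_; _⇔_; mk⇔)
open import Induction.WellFounded using (Acc; acc)
open import Relation.Binary.Construct.Closure.ReflexiveTransitive using (Star; ε; _◅_)
open import Relation.Binary.PropositionalEquality using (_≡_; _≢_; refl; sym)
open import Relation.Nullary using (¬_)

-- Operators are typed at the level of kinds; sorts are unary predicates on
-- kinds.  Subsorts and order-sorted operator declarations are memberships.

record Signature : Set₁ where
  field
    Kind Sort Op : Set
    sortKind     : Sort → Kind
    dom          : Op → List Kind
    cod          : Op → Kind

module Terms (S : Signature) where
  open Signature S

  Ctx : Set
  Ctx = List Kind

  data Term (Γ : Ctx) : Kind → Set where
    var : ∀ {k} → k ∈ Γ → Term Γ k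
    op  : (f : Op) → All (Term Γ) (dom f) → Term Γ (cod f)

  Ground : Kind → Set
  Ground = Term []

  Sub : Ctx → Ctx → Set
  Sub Γ Δ = All (Term Δ) Γ

  GSub : Ctx → Set
  GSub Γ = Sub Γ []

  infix 20 _[_] _[_]*

  mutual
    _[_] : ∀ {Γ Δ k} → Term Γ k → Sub Γ Δ → Term Δ k
    var x   [ σ ] = lookup σ x
    op f ts [ σ ] = op f (ts [ σ ]*)

    _[_]* : ∀ {Γ Δ ks} → All (Term Γ) ks → Sub Γ Δ → All (Term Δ) ks
    []       [ σ ]* = []
    (t ∷ ts) [ σ ]* = t [ σ ] ∷ ts [ σ ]*

  weaken : ∀ {Γ k} → Ground k → Term Γ k
  weaken t = t [ [] ]

  data Occurs {Γ j} (x : j ∈ Γ) : ∀ {k} → Term Γ k → Set where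
    here  : Occurs x (var x)
    there : ∀ {f ts i} (y : i ∈ dom f) → Occurs x (lookup ts y) → Occurs x (op f ts)

  -- Partial ground substitutions; applying one is undefined when the term
  -- has an unbound variable.

  PSub : Ctx → Set
  PSub Γ = All (λ k → Maybe (Ground k)) Γ

  total : ∀ {Γ} → GSub Γ → PSub Γ
  total = All.map just

  _⊑_ : ∀ {Γ} → PSub Γ → PSub Γ → Set
  _⊑_ {Γ} σ τ = ∀ {k} (x : k ∈ Γ) {t} → lookup σ x ≡ just t → lookup τ x ≡ just t

  infix 20 _[_]? _[_]?*

  mutual
    _[_]? : ∀ {Γ k} → Term Γ k → PSub Γ → Maybe (Ground k)
    var x   [ σ ]? = lookup σ x
    op f ts [ σ ]? = Maybe.map (op f) (ts [ σ ]?*)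

    _[_]?* : ∀ {Γ ks} → All (Term Γ) ks → PSub Γ → Maybe (All Ground ks)
    []       [ σ ]?* = just []
    (t ∷ ts) [ σ ]?* = Maybe.zipWith _∷_ (t [ σ ]?) (ts [ σ ]?*)

  -- One-hole ground contexts.  The argument stored at the position of the
  -- hole is overwritten by plug, so its value is irrelevant.

  data Hole (j : Kind) : Kind → Set where
    □  : Hole j j
    op : ∀ {k} (f : Op) → All Ground (dom f) → k ∈ dom f → Hole j k → Hole j (cod f)

  plug : ∀ {j k} → Hole j k → Ground j → Ground k
  plug □             t = t
  plug (op f ts x c) t = op f (ts [ x ]≔ plug c t)

  infix 4 _≐_

  data Atom (Γ : Ctx) : Set where
    _≐_ : ∀ {k} → Term Γ k → Term Γ k → Atom Γ
    mem : (s : Sort) → Term Γ (sortKind s) → Atom Γ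

  _[_]ᵃ : ∀ {Γ Δ} → Atom Γ → Sub Γ Δ → Atom Δ
  (t ≐ u) [ σ ]ᵃ = t [ σ ] ≐ u [ σ ]
  mem s t [ σ ]ᵃ = mem s (t [ σ ])

  record Sentence : Set where
    field
      vars       : Ctx
      conditions : List (Atom vars)
      conclusion : Atom vars

  data Fragment (Γ : Ctx) : Set where
    atom : Atom Γ → Fragment Γ
    _⇒_  : ∀ {k} → Term Γ k → Term Γ k → Fragment Γ

  rewritings : ∀ {Γ} → List (Fragment Γ) → ℕ
  rewritings []             = zero
  rewritings (atom _  ∷ fs) = rewritings fs
  rewritings (_ ⇒ _   ∷ fs) = suc (rewritings fs)

  -- Rule variables are named so that initial substitutions x ← t can refer
  -- to them; a variable is identified by its name and kind.

  record Rule (Label : Set) : Set where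
    field
      label     : Label
      vars      : Ctx
      names     : All (λ _ → ℕ) vars
      {kind}    : Kind
      lhs rhs   : Term vars kind
      condition : List (Fragment vars)

record Theory : Set₁ where
  field
    signature : Signature
  open Terms signature
  field
    Axiom : Set
    axiom : Axiom → Sentence

record RewriteTheory : Set₁ where
  field
    theory : Theory
  open Terms (Theory.signature theory)
  field
    Label  : Set
    RuleId : Set
    rule   : RuleId → Rule Label

module Deduction (T : Theory) where
  open Theory T
  open Terms signature

  -- Ground deduction; its equality and memberships are those of the initial
  -- algebra T_{Σ/E}.

  data Holds : Atom [] → Set where
    ax     : ∀ a → let open Sentence (axiom a) in
             (σ : GSub vars) → All (λ c → Holds (c [ σ ]ᵃ)) conditions →
             Holds (conclusion [ σ ]ᵃ)
    ≐-refl  : ∀ {k} {t : Ground k} → Holds (t ≐ t)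
    ≐-sym   : ∀ {k} {t u : Ground k} → Holds (t ≐ u) → Holds (u ≐ t)
    ≐-trans : ∀ {k} {t u v : Ground k} → Holds (t ≐ u) → Holds (u ≐ v) → Holds (t ≐ v)
    ≐-cong  : ∀ f {ts us : All Ground (Signature.dom signature f)} →
              (∀ {k} (x : k ∈ Signature.dom signature f) → Holds (lookup ts x ≐ lookup us x)) →
              Holds (op f ts ≐ op f us)
    ≐-mem   : ∀ {s t u} → Holds (t ≐ u) → Holds (mem s t) → Holds (mem s u)

  infix 4 _≈_ _≋_

  _≈_ : ∀ {k} → Ground k → Ground k → Set
  t ≈ u = Holds (t ≐ u)

  State : Set
  State = ∃ Ground

  data _≋_ : State → State → Set where
    same : ∀ {k} {t u : Ground k} → t ≈ u → (k , t) ≋ (k , u)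

data Scope : Set where
  anywhere root : Scope

module Rewriting (𝓡 : RewriteTheory) where
  open RewriteTheory 𝓡
  open Theory theory public using (signature)
  open Signature signature public
  open Terms signature public
  open Deduction theory public

  data Admits {j} : ∀ {k} → Scope → Hole j k → Set where
    anywhere : ∀ {k} {c : Hole j k} → Admits anywhere c
    root     : Admits root □

  mutual
    data Rewrite (w : Scope) {k} (t u : Ground k) : Set where
      rewrite-with : ∀ i → let open Rule (rule i) in
                     (c : Hole kind k) → Admits w c → (σ : GSub vars) →
                     t ≈ plug c (lhs [ σ ]) → All (Satisfies σ) condition →
                     plug c (rhs [ σ ]) ≈ u → Rewrite w t u

    data Satisfies {Γ} (σ : GSub Γ) : Fragment Γ → Set where
      atom : ∀ {a} → Holds (a [ σ ]ᵃ) → Satisfies σ (atom a)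
      _⇒_  : ∀ {k} {l p : Term Γ k} {v} → Star (Rewrite anywhere) (l [ σ ]) v →
             v ≈ p [ σ ] → Satisfies σ (l ⇒ p)

  infix 4 _⟶_ _⟶ˢ_

  _⟶_ : ∀ {k} → Ground k → Ground k → Set
  _⟶_ = Rewrite anywhere

  data _⟶ˢ_ : State → State → Set where
    step : ∀ {k} {t u : Ground k} → t ⟶ u → (k , t) ⟶ˢ (k , u)

module Strategies (𝓡 : RewriteTheory) where
  open RewriteTheory 𝓡
  open Rewriting 𝓡

  infixr 6 _⨟_
  infixr 5 _∣_
  infix  4 _¿_∶_

  -- Strat Γ contains the expressions with free variables Γ.  In match and
  -- matchrew, the pattern and condition may use Γ and bind new variables; Ξ
  -- are those assigned a strategy by matchrew, Δ the others.

  data Strat {names : ℕ} (params : Fin names → Ctx) (Γ : Ctx) : Set where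
    idle fail : Strat params Γ
    match     : ∀ Δ {k} → Term (Δ ++ Γ) k → List (Atom (Δ ++ Γ)) → Strat params Γ
    _⨟_ _∣_   : Strat params Γ → Strat params Γ → Strat params Γ
    _⋆        : Strat params Γ → Strat params Γ
    _¿_∶_     : Strat params Γ → Strat params Γ → Strat params Γ → Strat params Γ
    matchrew  : ∀ Ξ Δ {k} (P : Term (Ξ ++ Δ ++ Γ) k) → List (Atom (Ξ ++ Δ ++ Γ)) →
                (∀ j (x : j ∈ Ξ) → Occurs (∈-++⁺ˡ x) P) →
                All (λ _ → Strat params (Ξ ++ Δ ++ Γ)) Ξ → Strat params Γ
    call      : (sl : Fin names) → All (Term Γ) (params sl) → Strat params Γ
    all       : Scope → Strat params Γ
    rl        : Scope → Label → List (ℕ × ∃ (Term Γ)) → List (Strat params Γ) → Strat params Γ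

  record Definition {names : ℕ} (params : Fin names → Ctx) (sl : Fin names) : Set where
    field
      vars      : Ctx
      patterns  : All (Term vars) (params sl)
      condition : List (Atom vars)
      body      : Strat params vars

  record StrategyModule : Set where
    field
      {names}     : ℕ
      params      : Fin names → Ctx
      definitions : (sl : Fin names) → List (Definition params sl)

module Semantics (𝓡 : RewriteTheory) (M : Strategies.StrategyModule 𝓡) where
  open RewriteTheory 𝓡
  open Rewriting 𝓡
  open Strategies 𝓡 hiding (Strat)
  open StrategyModule M using (params; definitions)

  Strat : Ctx → Set
  Strat = Strategies.Strat 𝓡 params

  infixr 5 _▹_ _▸_
  infix  4 _＠_

  -- Stack Γ contains the stacks s whose vctx(s) binds the variables Γ.

  data Stack : Ctx → Set where
    ε   : Stack []
    _▹_ : ∀ {Γ} → Strat Γ → Stack Γ → Stack Γ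
    _▸_ : ∀ {Γ Δ} → GSub Δ → Stack Γ → Stack Δ

  vctx : ∀ {Γ} → Stack Γ → GSub Γ
  vctx ε       = []
  vctx (_ ▹ s) = vctx s
  vctx (θ ▸ _) = θ

  enter : ∀ {Γ Δ} → GSub Δ → Stack Γ → Stack Δ
  enter σ (_ ▸ s) = σ ▸ s
  enter σ s       = σ ▸ s

  data XS : Kind → Set where
    _＠_    : ∀ {k Γ} → Ground k → Stack Γ → XS k
    subterm : ∀ {k Ξ Γ} → All XS Ξ → Term Ξ k → Stack Γ → XS k
    rewc    : ∀ {k i j Γ Δ Γ′} (p : Term Δ j) (q : XS j) (σ : PSub Δ) (C : List (Fragment Δ)) →
              List (Strat Γ) → (θ : GSub Γ) (r : Term Δ i) (c : Hole i k) (t : Ground k) →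
              Stack Γ′ → XS k

  mutual
    cterm : ∀ {k} → XS k → Ground k
    cterm (t ＠ _)                   = t
    cterm (subterm qs t _)           = t [ cterms qs ]
    cterm (rewc _ _ _ _ _ _ _ _ t _) = t

    cterms : ∀ {Ξ} → All XS Ξ → GSub Ξ
    cterms []       = []
    cterms (q ∷ qs) = cterm q ∷ cterms qs

  solution : ∀ {k} → Ground k → XS k
  solution t = t ＠ ε

  launch : ∀ {Ξ Γ} → GSub Γ → GSub Ξ → All (λ _ → Strat Γ) Ξ → All XS Ξ
  launch σ []      []       = []
  launch σ (t ∷ ξ) (α ∷ αs) = (t ＠ α ▹ σ ▸ ε) ∷ launch σ ξ αs

  -- σ extends the initial substitution ρ instantiated by θ.

  Extends : ∀ {Γ Δ} → List (ℕ × ∃ (Term Γ)) → GSub Γ → All (λ _ → ℕ) Δ → PSub Δ → Set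
  Extends ρ θ names σ =
    ∀ {n j t} → (n , j , t) ∈ ρ → (x : j ∈ _) → lookup names x ≡ n →
    ∃[ u ] lookup σ x ≡ just u × u ≈ t [ θ ]

  data HoldsUnder {Γ} (σ : PSub Γ) : Atom Γ → Set where
    eq  : ∀ {k} {t u : Term Γ k} {t′ u′} → t [ σ ]? ≡ just t′ → u [ σ ]? ≡ just u′ →
          t′ ≈ u′ → HoldsUnder σ (t ≐ u)
    mem : ∀ {s t t′} → t [ σ ]? ≡ just t′ → Holds (mem s t′) → HoldsUnder σ (mem s t)

  data Mode : Set where
    ctl sys : Mode

  -- The transitions depend, through the negative branch of conditionals, on
  -- which states fail (terminate without reaching a solution), and failing
  -- depends on the transitions.  Step is therefore parameterized by the
  -- predicate Fails, which is defined from it afterwards.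

  data Step (Fails : ∀ {k} → XS k → Set) : ∀ {k} → Mode → XS k → XS k → Set where
    idle   : ∀ {k Γ} {t : Ground k} {s : Stack Γ} →
             Step Fails ctl (t ＠ idle ▹ s) (t ＠ s)
    pop    : ∀ {k Γ Δ} {t : Ground k} {θ : GSub Δ} {s : Stack Γ} →
             Step Fails ctl (t ＠ θ ▸ s) (t ＠ s)
    match  : ∀ {k Γ Δ} {t : Ground k} {s : Stack Γ} {P : Term (Δ ++ Γ) k} {C} →
             (δ : GSub Δ) → let σ = ++⁺ δ (vctx s) in
             t ≈ P [ σ ] → All (λ c → Holds (c [ σ ]ᵃ)) C →
             Step Fails ctl (t ＠ match Δ P C ▹ s) (t ＠ s)
    seq    : ∀ {k Γ} {t : Ground k} {s : Stack Γ} {α β} →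
             Step Fails ctl (t ＠ (α ⨟ β) ▹ s) (t ＠ α ▹ β ▹ s)
    choice₁ : ∀ {k Γ} {t : Ground k} {s : Stack Γ} {α β} →
             Step Fails ctl (t ＠ (α ∣ β) ▹ s) (t ＠ α ▹ s)
    choice₂ : ∀ {k Γ} {t : Ground k} {s : Stack Γ} {α β} →
             Step Fails ctl (t ＠ (α ∣ β) ▹ s) (t ＠ β ▹ s)
    stop   : ∀ {k Γ} {t : Ground k} {s : Stack Γ} {α} →
             Step Fails ctl (t ＠ (α ⋆) ▹ s) (t ＠ s)
    iter   : ∀ {k Γ} {t : Ground k} {s : Stack Γ} {α} →
             Step Fails ctl (t ＠ (α ⋆) ▹ s) (t ＠ α ▹ (α ⋆) ▹ s)
    then   : ∀ {k Γ} {t : Ground k} {s : Stack Γ} {α β γ} →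
             Step Fails ctl (t ＠ (α ¿ β ∶ γ) ▹ s) (t ＠ α ▹ β ▹ s)
    else   : ∀ {k Γ} {t : Ground k} {s : Stack Γ} {α β γ} →
             Fails (t ＠ α ▹ vctx s ▸ ε) →
             Step Fails ctl (t ＠ (α ¿ β ∶ γ) ▹ s) (t ＠ γ ▹ s)
    all    : ∀ {k Γ w} {t t′ : Ground k} {s : Stack Γ} → Rewrite w t t′ →
             Step Fails sys (t ＠ all w ▹ s) (t′ ＠ s)
    rl     : ∀ {k Γ w ρ} {t t′ : Ground k} {s : Stack Γ} →
             ∀ i → let open Rule (rule i) in
             ∀ {ℓ} → label ≡ ℓ → rewritings condition ≡ 0 →
             (c : Hole kind k) → Admits w c → (σ : GSub vars) →
             Extends ρ (vctx s) names (total σ) → t ≈ plug c (lhs [ σ ]) →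
             All (Satisfies σ) condition → plug c (rhs [ σ ]) ≈ t′ →
             Step Fails sys (t ＠ rl w ℓ ρ [] ▹ s) (t′ ＠ s)
    rewc-start : ∀ {k j Γ w ρ α αs} {t : Ground k} {s : Stack Γ} →
             ∀ i → let open Rule (rule i) in
             ∀ {C₀ C} {l p : Term vars j} {u v} →
             ∀ {ℓ} → label ≡ ℓ → condition ≡ map atom C₀ ++ (l ⇒ p) ∷ C → length αs ≡ rewritings C →
             (c : Hole kind k) → Admits w c → (σ : PSub vars) →
             Extends ρ (vctx s) names σ → lhs [ σ ]? ≡ just u → t ≈ plug c u →
             All (HoldsUnder σ) C₀ → l [ σ ]? ≡ just v →
             Step Fails ctl (t ＠ rl w ℓ ρ (α ∷ αs) ▹ s)
               (rewc p (v ＠ α ▹ vctx s ▸ ε) σ C αs (vctx s) rhs c t s)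
    rewc-in : ∀ {m k i j Γ Δ Γ′} {p : Term Δ j} {q q′ : XS j} {σ C} {αs : List (Strat Γ)} {θ}
              {r : Term Δ i} {c : Hole i k} {t} {s : Stack Γ′} →
             Step Fails m q q′ →
             Step Fails ctl (rewc p q σ C αs θ r c t s) (rewc p q′ σ C αs θ r c t s)
    rewc-next : ∀ {k i j j′ Γ Δ Γ′} {p : Term Δ j} {t′} {σ : PSub Δ} {D C₀ C} {l p′ : Term Δ j′}
              {α αs} {θ : GSub Γ} {r : Term Δ i} {c : Hole i k} {t} {s : Stack Γ′} →
             D ≡ map atom C₀ ++ (l ⇒ p′) ∷ C →
             ∀ σ′ {u v} → σ ⊑ σ′ → p [ σ′ ]? ≡ just u → u ≈ t′ →
             All (HoldsUnder σ′) C₀ → l [ σ′ ]? ≡ just v →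
             Step Fails ctl (rewc p (solution t′) σ D (α ∷ αs) θ r c t s)
               (rewc p′ (v ＠ α ▹ θ ▸ ε) σ′ C αs θ r c t s)
    rewc-end : ∀ {k i j Γ Δ Γ′} {p : Term Δ j} {t′} {σ : PSub Δ} {D C₀}
              {θ : GSub Γ} {r : Term Δ i} {c : Hole i k} {t} {s : Stack Γ′} →
             D ≡ map atom C₀ →
             ∀ σ′ {u v} → σ ⊑ σ′ → p [ σ′ ]? ≡ just u → u ≈ t′ →
             All (HoldsUnder σ′) C₀ → r [ σ′ ]? ≡ just v →
             Step Fails sys (rewc p (solution t′) σ D [] θ r c t s) (plug c v ＠ s)
    subterm-start : ∀ {k Γ Ξ Δ} {t : Ground k} {s : Stack Γ} {P : Term (Ξ ++ Δ ++ Γ) k} {C occ αs} →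
             (ξ : GSub Ξ) (δ : GSub Δ) → let δθ = ++⁺ δ (vctx s) ; σ = ++⁺ ξ δθ in
             t ≈ P [ σ ] → All (λ c → Holds (c [ σ ]ᵃ)) C →
             Step Fails ctl (t ＠ matchrew Ξ Δ P C occ αs ▹ s)
               (subterm (launch σ ξ αs)
                        (P [ ++⁺ (tabulate var) (All.map weaken δθ) ]) s)
    subterm-in : ∀ {m k j Ξ Γ} {qs : All XS Ξ} {t : Term Ξ k} {s : Stack Γ} →
             (x : j ∈ Ξ) {q : XS j} → Step Fails m (lookup qs x) q →
             Step Fails m (subterm qs t s) (subterm (qs [ x ]≔ q) t s)
    subterm-end : ∀ {k Ξ Γ} {t : Term Ξ k} {s : Stack Γ} {qs} (ts : GSub Ξ) →
             qs ≡ All.map solution ts →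
             Step Fails ctl (subterm qs t s) (t [ ts ] ＠ s)
    call   : ∀ {k Γ} {t : Ground k} {s : Stack Γ} →
             ∀ {sl d} → d ∈ definitions sl → let open Definition d in
             ∀ {ts : All (Term Γ) (params sl)} (σ : GSub vars) →
             (∀ {j} (x : j ∈ params sl) → lookup patterns x [ σ ] ≈ lookup ts x [ vctx s ]) →
             All (λ c → Holds (c [ σ ]ᵃ)) condition →
             Step Fails ctl (t ＠ call sl ts ▹ s) (t ＠ body ▹ enter σ s)

  -- The states on whose failure the transitions leaving q depend.

  data Tests : ∀ {k j} → XS k → XS j → Set where
    cond    : ∀ {k Γ} {t : Ground k} {s : Stack Γ} {α β γ} →
              Tests (t ＠ (α ¿ β ∶ γ) ▹ s) (t ＠ α ▹ vctx s ▸ ε)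
    rewc    : ∀ {k i j j′ Γ Δ Γ′} {p : Term Δ j} {q : XS j} {q′ : XS j′} {σ C} {αs : List (Strat Γ)} {θ}
              {r : Term Δ i} {c : Hole i k} {t} {s : Stack Γ′} →
              Tests q q′ → Tests (rewc p q σ C αs θ r c t s) q′
    subterm : ∀ {k j j′ Ξ Γ} {qs : All XS Ξ} {t : Term Ξ k} {s : Stack Γ} {q′ : XS j′} →
              (x : j ∈ Ξ) → Tests (lookup qs x) q′ → Tests (subterm qs t s) q′

  -- Halts q: every sequence of transitions from q is finite.  The transitions
  -- are determined along the way: a tested state t @ αθ halts as well, since
  -- the positive branch t @ αβs runs α from the same term and bindings.
  -- Solves h: a solution is reachable from the halting state.

  mutual
    data Halts {k} (q : XS k) : Set where
      halts : (tests : ∀ {j} {q′ : XS j} → Tests q q′ → Halts q′) →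
              (∀ {m q′} → Step (λ p → Σ[ d ∈ Tests q p ] ¬ Solves (tests d)) m q q′ → Halts q′) →
              Halts q

    Solves : ∀ {k} {q : XS k} → Halts q → Set
    Solves {q = q} (halts tests next) =
      (∃[ t ] q ≡ solution t) ⊎
      (∃[ m ] ∃[ q′ ] Σ[ st ∈ Step (λ p → Σ[ d ∈ Tests q p ] ¬ Solves (tests d)) m q q′ ]
         Solves (next st))

  Fails : ∀ {k} → XS k → Set
  Fails q = Σ[ h ∈ Halts q ] ¬ Solves h

  infix 4 _→c_ _→s_ _→c*_ _↠_

  _→c_ _→s_ _→c*_ _↠_ : ∀ {k} → XS k → XS k → Set
  _→c_ = Step Fails ctl
  _→s_ = Step Fails sys
  _→c*_ = Star _→c_
  q ↠ q′ = ∃[ p ] (q →c* p) × (p →s q′)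

  infixr 5 _∷_

  data Ex* {k} : XS k → List (XS k) → Set where
    end : ∀ {q t} → q →c* solution t → Ex* q (q ∷ [])
    _∷_ : ∀ {q q′ qs} → q ↠ q′ → Ex* q′ qs → Ex* q (q ∷ qs)

  Exω : ∀ {k} → XS k → (ℕ → XS k) → Set
  Exω q₀ q = q 0 ≡ q₀ × (∀ i → q i ↠ q (suc i))

module Adequacy (𝓡 : RewriteTheory) (M : Strategies.StrategyModule 𝓡) where
  open RewriteTheory 𝓡
  open Rewriting 𝓡
  open Strategies 𝓡 hiding (Strat)
  open Semantics 𝓡 M

  Oracle : Set₁
  Oracle = ∀ {k} → XS k → Set

  mono : {P Q : Oracle} → ∀ {k m} {q q′ : XS k} →
         (∀ {j} {p : XS j} → Tests q p → P p → Q p) → Step P m q q′ → Step Q m q q′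
  mono f idle = idle
  mono f pop = pop
  mono f (match δ x x₁) = match δ x x₁
  mono f seq = seq
  mono f choice₁ = choice₁
  mono f choice₂ = choice₂
  mono f stop = stop
  mono f iter = iter
  mono f then = then
  mono f (else x) = else (f cond x)
  mono f (all x) = all x
  mono f (rl i l e c a σ x m s r) = rl i l e c a σ x m s r
  mono f (rewc-start i l e n c a σ x m s r h) = rewc-start i l e n c a σ x m s r h
  mono f (rewc-in st) = rewc-in (mono (f ∘ rewc) st)
  mono f (rewc-next e σ′ a b c d x) = rewc-next e σ′ a b c d x
  mono f (rewc-end e σ′ a b c d x) = rewc-end e σ′ a b c d x
  mono f (subterm-start ξ δ a b) = subterm-start ξ δ a b
  mono f (subterm-in x st) = subterm-in x (mono (f ∘ subterm x) st)
  mono f (subterm-end ts e) = subterm-end ts e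
  mono f (call d σ a b) = call d σ a b

  data SR : ∀ {Γ} → Stack Γ → Stack Γ → Set where
    bot  : ∀ {Γ} {θ} {s : Stack Γ} → θ ≡ vctx s → SR (θ ▸ ε) s
    _▹_  : ∀ {Γ} (α : Strat Γ) {s s′} → SR s s′ → SR (α ▹ s) (α ▹ s′)
    _▸_  : ∀ {Γ Δ} (θ : GSub Δ) {s s′ : Stack Γ} → SR s s′ → SR (θ ▸ s) (θ ▸ s′)

  -- R q q′: q′ tests whatever q tests and can follow every transition of q,
  -- except those into a solution.

  data R : ∀ {k j} → XS k → XS j → Set where
    at   : ∀ {k Γ} {t : Ground k} {s s′ : Stack Γ} → SR s s′ → R (t ＠ s) (t ＠ s′)
    subS : ∀ {k Ξ Γ} {qs : All XS Ξ} {t : Term Ξ k} {s s′ : Stack Γ} → SR s s′ →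
           R (subterm qs t s) (subterm qs t s′)
    rewS : ∀ {k i j Γ Δ Γ′} {p : Term Δ j} {q : XS j} {σ C} {αs : List (Strat Γ)} {θ}
              {r : Term Δ i} {c : Hole i k} {t} {s s′ : Stack Γ′} → SR s s′ →
           R (rewc p q σ C αs θ r c t s) (rewc p q σ C αs θ r c t s′)
    inS  : ∀ {k j Ξ Γ} {qs : All XS Ξ} {t : Term Ξ k} {s : Stack Γ} (x : j ∈ Ξ) {q} → q ≡ lookup qs x →
           R q (subterm qs t s)
    inR  : ∀ {k i j Γ Δ Γ′} {p : Term Δ j} {q : XS j} {σ C} {αs : List (Strat Γ)} {θ}
              {r : Term Δ i} {c : Hole i k} {t} {s : Stack Γ′} →
           R q (rewc p q σ C αs θ r c t s)

  vctx-SR : ∀ {Γ} {s s′ : Stack Γ} → SR s s′ → vctx s ≡ vctx s′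
  vctx-SR (bot e) = e
  vctx-SR (α ▹ r) = vctx-SR r
  vctx-SR (θ ▸ r) = refl

  enter-SR : ∀ {Γ Δ} {s s′ : Stack Γ} (σ : GSub Δ) → SR s s′ → SR (enter σ s) (enter σ s′)
  enter-SR {s′ = s′} σ (bot e) = bot (vctx-enter s′)
    where
    vctx-enter : ∀ {Γ} (s : Stack Γ) → σ ≡ vctx (enter σ s)
    vctx-enter ε = refl
    vctx-enter (_ ▹ _) = refl
    vctx-enter (_ ▸ _) = refl
  enter-SR σ (α ▹ r) = σ ▸ (α ▹ r)
  enter-SR σ (θ ▸ r) = σ ▸ r

  lookup≔ : ∀ {Ξ j} (qs : All XS Ξ) (x : j ∈ Ξ) {q} → lookup (qs [ x ]≔ q) x ≡ q
  lookup≔ (_ ∷ _) (here refl) = refl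
  lookup≔ (_ ∷ qs) (there x) = lookup≔ qs x

  tests-R : ∀ {k j i} {q : XS k} {q′ : XS j} {p : XS i} → R q q′ → Tests q p → Tests q′ p
  tests-R (at {s = _} (_ ▹ r)) cond rewrite vctx-SR r = cond
  tests-R (subS _) (subterm x d) = subterm x d
  tests-R (rewS _) (rewc d) = rewc d
  tests-R (inS x refl) d = subterm x d
  tests-R inR d = rewc d

  sim : {P : Oracle} → ∀ {k j m} {q q₁ : XS k} {q′ : XS j} → R q q′ → Step P m q q₁ →
        (∃[ m′ ] ∃[ q₁′ ] Step P m′ q′ q₁′ × R q₁ q₁′) ⊎ (∃[ t ] q₁ ≡ solution t)
  sim (inS {qs = qs} x refl) st = inj₁ (_ , _ , subterm-in x st , inS x (sym (lookup≔ qs x)))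
  sim inR st = inj₁ (_ , _ , rewc-in st , inR)
  sim (at (bot _)) pop = inj₂ (_ , refl)
  sim (at (θ ▸ r)) pop = inj₁ (_ , _ , pop , at r)
  sim (at (_ ▹ r)) idle = inj₁ (_ , _ , idle , at r)
  sim (at (_ ▹ r)) (match δ x y) rewrite vctx-SR r = inj₁ (_ , _ , match δ x y , at r)
  sim (at (_ ▹ r)) seq = inj₁ (_ , _ , seq , at (_ ▹ (_ ▹ r)))
  sim (at (_ ▹ r)) choice₁ = inj₁ (_ , _ , choice₁ , at (_ ▹ r))
  sim (at (_ ▹ r)) choice₂ = inj₁ (_ , _ , choice₂ , at (_ ▹ r))
  sim (at (_ ▹ r)) stop = inj₁ (_ , _ , stop , at r)
  sim (at (_ ▹ r)) iter = inj₁ (_ , _ , iter , at (_ ▹ (_ ▹ r)))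
  sim (at (_ ▹ r)) then = inj₁ (_ , _ , then , at (_ ▹ (_ ▹ r)))
  sim (at (_ ▹ r)) (else x) rewrite vctx-SR r = inj₁ (_ , _ , else x , at (_ ▹ r))
  sim (at (_ ▹ r)) (all x) = inj₁ (_ , _ , all x , at r)
  sim (at (_ ▹ r)) (rl i l e c a σ x m s u) rewrite vctx-SR r =
    inj₁ (_ , _ , rl i l e c a σ x m s u , at r)
  sim (at (_ ▹ r)) (rewc-start i l e n c a σ x m s u h) rewrite vctx-SR r =
    inj₁ (_ , _ , rewc-start i l e n c a σ x m s u h , rewS r)
  sim (at (_ ▹ r)) (subterm-start ξ δ a b) rewrite vctx-SR r =
    inj₁ (_ , _ , subterm-start ξ δ a b , subS r)
  sim (at (_ ▹ r)) (call d σ a b) rewrite vctx-SR r =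
    inj₁ (_ , _ , call d σ a b , at (_ ▹ enter-SR σ r))
  sim (subS r) (subterm-in x st) = inj₁ (_ , _ , subterm-in x st , subS r)
  sim (subS r) (subterm-end ts e) = inj₁ (_ , _ , subterm-end ts e , at r)
  sim (rewS r) (rewc-in st) = inj₁ (_ , _ , rewc-in st , rewS r)
  sim (rewS r) (rewc-next e σ′ a b c d x) = inj₁ (_ , _ , rewc-next e σ′ a b c d x , rewS r)
  sim (rewS r) (rewc-end e σ′ a b c d x) = inj₁ (_ , _ , rewc-end e σ′ a b c d x , at r)

  sol-halts : ∀ {k} {t : Ground k} → Halts (solution t)
  sol-halts = halts (λ ()) (λ ())

  halts-R : ∀ {k j} {q : XS k} {q′ : XS j} → R q q′ → Halts q′ → Halts q
  halts-R {q = q} r (halts ts next) = halts (λ d → ts (tests-R r d)) go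
    where
    go : ∀ {m q₁} → Step _ m q q₁ → Halts q₁
    go st with sim r st
    ... | inj₂ (_ , refl) = sol-halts
    ... | inj₁ (_ , _ , st′ , r′) =
      halts-R r′ (next (mono (λ { _ (d , n) → tests-R r d , n }) st′))

  irr : ∀ {k} {q : XS k} (h h′ : Halts q) → Solves h → Solves h′
  irr (halts ts next) (halts ts′ next′) (inj₁ e) = inj₁ e
  irr (halts ts next) (halts ts′ next′) (inj₂ (m , q′ , st , s)) =
    inj₂ (m , q′ , st′ , irr (next st) (next′ st′) s)
    where st′ = mono (λ { _ (d , n) → d , λ s → n (irr (ts′ d) (ts d) s) }) st

  _→sc_ : ∀ {k} → XS k → XS k → Set
  q →sc q′ = ∃[ m ] Step Fails m q q′

  Terminating Solvable : ∀ {k} → XS k → Set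
  Terminating = Acc (λ q′ q → q →sc q′)
  Solvable q = ∃[ t ] Star _→sc_ q (solution t)

  up : ∀ {k m} {q q′ : XS k} (ts : ∀ {j} {p : XS j} → Tests q p → Halts p) → Step Fails m q q′ →
       Step (λ p → Σ[ d ∈ Tests q p ] ¬ Solves (ts d)) m q q′
  up ts = mono λ { d (h , n) → d , λ s → n (irr (ts d) h s) }

  halts→term : ∀ {k} {q : XS k} → Halts q → Terminating q
  halts→term (halts ts next) = acc λ { (_ , st) → halts→term (next (up ts st)) }

  solves→ : ∀ {k} {q : XS k} (h : Halts q) → Solves h → Solvable q
  solves→ (halts ts next) (inj₁ (t , refl)) = t , ε
  solves→ (halts ts next) (inj₂ (m , q′ , st , s)) with solves→ (next st) s
  ... | t , xs = t , (m , mono (λ { _ (d , n) → ts d , n }) st) ◅ xs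

  →solves : ∀ {k} {q : XS k} {t} (h : Halts q) → Star _→sc_ q (solution t) → Solves h
  →solves (halts ts next) ε = inj₁ (_ , refl)
  →solves (halts ts next) ((m , st) ◅ xs) = inj₂ (_ , _ , up ts st , →solves (next (up ts st)) xs)

  dominated : ∀ {P : Oracle} {k j} {q : XS k} {p : XS j} → Tests q p →
        ∃[ q′ ] Step P ctl q q′ × (Halts q′ → Halts p)
  dominated cond = _ , then , halts-R (at (_ ▹ bot refl))
  dominated (rewc d) with dominated d
  ... | _ , st , f = _ , rewc-in st , f ∘ halts-R inR
  dominated (subterm {qs = qs} x d) with dominated d
  ... | _ , st , f = _ , subterm-in x st , f ∘ halts-R (inS x (sym (lookup≔ qs x)))

  term→halts : ∀ {k} {q : XS k} → Terminating q → Halts q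
  term→halts (acc rs) = halts ts (λ st → term→halts (rs (_ , mono (λ { _ (d , n) → ts d , n }) st)))
    where ts : ∀ {j} {p : XS j} → Tests _ p → Halts p
          ts d with dominated d
          ... | q′ , st , f = f (term→halts (rs (_ , st)))

  -- Fails satisfies the side condition of the negative branch literally, for
  -- the transition relation it determines.

  adequate : ∀ {k} (q : XS k) → Fails q ⇔ (Terminating q × ¬ Solvable q)
  adequate q = mk⇔ (λ { (h , n) → halts→term h , λ { (_ , xs) → n (→solves h xs) } })
                   (λ { (a , n) → term→halts a , λ s → n (solves→ _ s) })

module _ (S : Signature) where
  open Signature S

  record SignatureExtension : Set where
    field
      newKinds newSorts newOps : ℕ

    Kind⁺ : Set
    Kind⁺ = Kind ⊎ Fin newKinds

    field
      newSortKind : Fin newSorts → Kind⁺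
      newDom      : Fin newOps → List Kind⁺
      newCod      : Fin newOps → Kind⁺

    extended : Signature
    extended = record
      { Kind     = Kind⁺
      ; Sort     = Sort ⊎ Fin newSorts
      ; Op       = Op ⊎ Fin newOps
      ; sortKind = [ inj₁ ∘ sortKind , newSortKind ]′
      ; dom      = [ map inj₁ ∘ dom , newDom ]′
      ; cod      = [ inj₁ ∘ cod , newCod ]′
      }

module Embedding {S : Signature} (X : SignatureExtension S) where
  open Terms S
  open SignatureExtension X using (extended)
  private module T = Terms extended

  mutual
    term : ∀ {Γ k} → Term Γ k → T.Term (map inj₁ Γ) (inj₁ k)
    term (var x)   = T.var (∈-map⁺ inj₁ x)
    term (op f ts) = T.op (inj₁ f) (terms ts)

    terms : ∀ {Γ ks} → All (Term Γ) ks → All (T.Term (map inj₁ Γ)) (map inj₁ ks)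
    terms []       = []
    terms (t ∷ ts) = term t ∷ terms ts

  atomic : ∀ {Γ} → Atom Γ → T.Atom (map inj₁ Γ)
  atomic (t ≐ u)   = term t T.≐ term u
  atomic (mem s t) = T.mem (inj₁ s) (term t)

  sentence : Sentence → T.Sentence
  sentence φ = record
    { vars       = map inj₁ vars
    ; conditions = map atomic conditions
    ; conclusion = atomic conclusion
    } where open Sentence φ

  fragment : ∀ {Γ} → Fragment Γ → T.Fragment (map inj₁ Γ)
  fragment (atom a) = T.atom (atomic a)
  fragment (l ⇒ p)  = term l T.⇒ term p

  rule : ∀ {Label} → Rule Label → T.Rule Label
  rule ϱ = record
    { label     = label
    ; vars      = map inj₁ vars
    ; names     = map⁺ names
    ; lhs       = term lhs
    ; rhs       = term rhs
    ; condition = map fragment condition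
    } where open Rule ϱ

record Language (A : Set) : Set₁ where
  field
    finite   : List A → Set
    infinite : (ℕ → A) → Set

open Language

infix 4 _⊆ᴸ_ _≈ᴸ_

_⊆ᴸ_ _≈ᴸ_ : ∀ {A} → Language A → Language A → Set
K ⊆ᴸ L = (∀ w → finite K w → finite L w) × (∀ w → infinite K w → infinite L w)
K ≈ᴸ L = (∀ w → finite K w ⇔ finite L w) × (∀ w → infinite K w ⇔ infinite L w)

module _ (𝓡 : RewriteTheory) where
  open RewriteTheory 𝓡
  open Rewriting 𝓡

  -- Finitely many new kinds, sorts, operators, equations and memberships.
  -- Rules are not added.

  record Extension : Set where
    field
      signatureExtension : SignatureExtension signature
    open SignatureExtension signatureExtension using (extended) public
    field
      newAxioms : List (Terms.Sentence extended)

    module Embed = Embedding signatureExtension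

    extendedTheory : RewriteTheory
    extendedTheory = record
      { theory = record
          { signature = extended
          ; Axiom     = Theory.Axiom theory ⊎ Fin (length newAxioms)
          ; axiom     = [ Embed.sentence ∘ Theory.axiom theory , lookupᴸ newAxioms ]′
          }
      ; Label  = Label
      ; RuleId = RuleId
      ; rule   = Embed.rule ∘ rule
      }

    private module R⁺ = Rewriting extendedTheory

    embedState : State → R⁺.State
    embedState (k , t) = inj₁ k , Embed.term t

    -- The terms of the old kinds, their equality and sorts, and their
    -- rewriting are unchanged.

    record Protecting : Set where
      field
        no-junk   : ∀ {k} (t′ : R⁺.Ground (inj₁ k)) → ∃[ t ] t′ R⁺.≈ Embed.term t
        equality  : ∀ {k} (t u : Ground k) → t ≈ u ⇔ (Embed.term t R⁺.≈ Embed.term u)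
        sorting   : ∀ s (t : Ground (sortKind s)) →
                    Holds (mem s t) ⇔ R⁺.Holds (R⁺.mem (inj₁ s) (Embed.term t))
        rewriting : ∀ {k} (t u : Ground k) → (t ⟶ u) ⇔ (Embed.term t R⁺.⟶ Embed.term u)

  executions : Language State
  executions = record
    { finite   = λ w → w ≢ [] × Linked _⟶ˢ_ w
    ; infinite = λ w → ∀ i → w i ⟶ˢ w (suc i)
    }

  module _ (X : Extension) where
    open Extension X
    private module R⁺ = Rewriting extendedTheory

    module _ (M : Strategies.StrategyModule extendedTheory) where
      open Semantics extendedTheory M

      current : ∀ {k} → XS k → R⁺.State
      current q = _ , cterm q

      -- E(α), as a language of words over T_Σ.

      E : Strat [] → Language State
      E α = record
        { finite   = λ w → ∃[ k ] Σ[ t ∈ Ground k ] ∃[ qs ]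
                     Ex* (Embed.term t ＠ α ▹ ε) qs ×
                     Pointwise (λ a q → embedState a R⁺.≋ current q) w qs
        ; infinite = λ w → ∃[ k ] Σ[ t ∈ Ground k ] ∃[ q ]
                     Exω (Embed.term t ＠ α ▹ ε) q ×
                     (∀ i → embedState (w i) R⁺.≋ current (q i))
        }

data Move : Set where
  left right : Move

-- Nondeterministic machines with input alphabet Fin n and a one-way infinite
-- tape.  The work symbol inj₂ zero is the blank.

record Machine (n : ℕ) : Set where
  field
    states work : ℕ

  Symbol : Set
  Symbol = Fin n ⊎ Fin (suc work)

  field
    start       : Fin states
    final       : Subset states
    transitions : List (Fin states × Symbol × Fin states × Symbol × Move)

module Computation {n} (M : Machine n) where
  open Machine M

  record Config : Set where
    constructor ⟨_,_,_⟩
    field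
      state    : Fin states
      position : ℕ
      tape     : ℕ → Symbol

  open Config

  data Moves : Move → ℕ → ℕ → Set where
    left  : ∀ {p} → Moves left (suc p) p
    right : ∀ {p} → Moves right p (suc p)

  record _⊢_ (c c′ : Config) : Set where
    field
      {move}     : Move
      transition : (state c , tape c (position c) ,
                    state c′ , tape c′ (position c) , move) ∈ transitions
      moves      : Moves move (position c) (position c′)
      unchanged  : ∀ i → i ≢ position c → tape c′ i ≡ tape c i

  Initial : (ℕ → Symbol) → Config → Set
  Initial w c = state c ≡ start × position c ≡ 0 × (∀ i → tape c i ≡ w i)

  padded : List (Fin n) → ℕ → Symbol
  padded []      _       = inj₂ Fin.zero
  padded (a ∷ _) zero    = inj₁ a
  padded (_ ∷ v) (suc i) = padded v i

  Accepts : List (Fin n) → Set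
  Accepts v = ∃[ c ] ∃[ c′ ] Initial (padded v) c × Star _⊢_ c c′ × state c′ ∈ˢ final

  -- Acceptance by a complete run satisfying the Büchi condition.

  Acceptsω : (ℕ → Fin n) → Set
  Acceptsω v = Σ[ r ∈ (ℕ → Config) ] Initial (inj₁ ∘ v) (r 0) × (∀ i → r i ⊢ r (suc i)) ×
               (∀ p → ∃[ i ] position (r i) ≡ p) ×
               (∀ i → ∃[ j ] i ≤ j × state (r j) ∈ˢ final)

open Computation using (Accepts; Acceptsω)

module _ (𝓡 : RewriteTheory) where
  open Rewriting 𝓡

  -- The alphabet is an enumeration of a finite subset of T_{Σ/E}.

  record ∞-RecursivelyEnumerable (L : Language State) : Set where
    field
      {size}          : ℕ
      letter          : Fin size → State
      letter-distinct : ∀ {a b} → letter a ≋ letter b → a ≡ b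
      acceptor        : Machine size
      finite-words    : ∀ w → finite L w ⇔
                        (∃[ v ] Accepts acceptor v × Pointwise (λ s a → s ≋ letter a) w v)
      ω-acceptor      : Machine size
      infinite-words  : ∀ w → infinite L w ⇔
                        (∃[ v ] Acceptsω ω-acceptor v × (∀ i → w i ≋ letter (v i)))

{-# OPTIONS --safe #-}

-- The extension adds binary trees and one predicate on them, axiomatized by a
-- Horn program.  The clauses run the two machines on the finite part of the
-- tape that has been read so far, and thereby define an automaton with trees as
-- states and the letters as labels.  A recursive strategy with the state of the
-- automaton as its argument guesses the next letter and state, tests the letter
-- on the current term, and rewrites once, so its executions are the words of
-- the automaton.
--
-- For finite words the automaton guesses the whole word and checks acceptance
-- at once.  For infinite words it guesses the next segment of the input such
-- that the machine, started at the first unread cell, visits a final state and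
-- leaves the segment to the right, emits the letters of the segment, and starts
-- over.  Hence an infinite execution passes through infinitely many segments,
-- which amounts to a complete run with the Büchi condition.

module Submission where

open import Data.Fin using (Fin; zero; suc)
open import Data.Fin.Subset using () renaming (_∈_ to _∈ˢ_)
open import Data.Fin.Subset.Properties using (_∈?_)
open import Data.List using (List; []; _∷_; _++_; map; replicate; length; allFin; filter)
open import Data.List.Membership.Propositional using (_∈_)
open import Data.List.Membership.Propositional.Properties
  using (∈-map⁺; ∈-map⁻; ∈-++⁺ˡ; ∈-++⁺ʳ; ∈-++⁻; ∈-lookup; ∈-allFin; ∈-filter⁺; ∈-filter⁻)
open import Data.List.Relation.Binary.Pointwise using (Pointwise; []; _∷_)
open import Data.List.Relation.Unary.All as All using (All; []; _∷_; _[_]≔_)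
import Data.List.Relation.Unary.All.Properties as All
open import Data.List.Relation.Unary.Any using (here; there; index)
open import Data.List.Relation.Unary.Any.Properties using (lookup-index)
open import Data.List.Relation.Unary.Linked using (Linked; _∷_)
open import Data.Nat
  using (ℕ; zero; suc; _+_; _≤_; _<_; z≤n; s≤s; _≟_; _≤‴_; ≤‴-refl; ≤‴-step)
open import Data.Nat.Properties
  using (+-comm; +-identityʳ; +-suc; suc-injective; m<m+n; n≤1+n;
         ≤-refl; ≤-reflexive; ≤-trans; ≤-pred; ≤∧≢⇒<; <⇒≤; <⇒≢; <⇒≱; ≤-<-trans; <-≤-trans;
         ≤⇒≤‴; ≤‴⇒≤)
open import Data.Product using (Σ-syntax; ∃-syntax; _×_; _,_; proj₁; proj₂)
open import Data.Sum using (_⊎_; inj₁; inj₂)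
open import Data.Unit using (⊤; tt)
open import Data.Vec as Vec using (Vec; []; _∷_)
open import Function using (_∘_; _∋_; _⇔_; mk⇔; Equivalence)
open import Relation.Binary.Construct.Closure.ReflexiveTransitive using (Star; ε; _◅_; _◅◅_)
open import Relation.Binary.PropositionalEquality
  using (_≡_; _≢_; _≗_; refl; sym; trans; cong; cong₂; subst; subst₂)
open import Relation.Nullary using (¬_; yes; no; contradiction)
open import Defs

-- Horn programs over binary trees as protecting extensions

infixr 6 _·_

data Tree : Set where
  nil : Tree
  _·_ : Tree → Tree → Tree

data Pattern (n : ℕ) : Set where
  var : Fin n → Pattern n
  con : Tree → Pattern n
  _·_ : Pattern n → Pattern n → Pattern n

infix 20 _⟨_⟩
infix 4 _⊩_

_⟨_⟩ : ∀ {n} → Pattern n → Vec Tree n → Tree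
var i   ⟨ σ ⟩ = Vec.lookup σ i
con t   ⟨ σ ⟩ = t
(p · q) ⟨ σ ⟩ = p ⟨ σ ⟩ · q ⟨ σ ⟩

record Clause : Set where
  constructor _⇐_
  field
    {arity}  : ℕ
    head     : Pattern arity
    premises : List (Pattern arity)

open Clause

data _⊩_ (Π : List Clause) : Tree → Set where
  by : ∀ {c} → c ∈ Π → (σ : Vec Tree (arity c)) →
       All (λ p → Π ⊩ p ⟨ σ ⟩) (premises c) → Π ⊩ head c ⟨ σ ⟩

module HornExtension (𝓡 : RewriteTheory) (Π : List Clause) where
  open RewriteTheory 𝓡 using (theory; rule)
  open Theory theory using (axiom)
  private module O = Rewriting 𝓡
  open O using (Kind; Ground; Term)

  treeSignature : SignatureExtension O.signature
  treeSignature = record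
    { newKinds = 1 ; newSorts = 1 ; newOps = 2
    ; newSortKind = λ _ → inj₂ zero
    ; newDom      = Vec.lookup ([] ∷ (inj₂ zero ∷ inj₂ zero ∷ []) ∷ [])
    ; newCod      = λ _ → inj₂ zero
    }

  open SignatureExtension treeSignature using (Kind⁺; extended)
  open Embedding treeSignature using (term; terms; atomic)
  private module T = Terms extended
  open T using (op; var; mem; _≐_; _[_]; _[_]ᵃ)

  pattern tree = inj₂ zero
  pattern leaf = op (inj₂ zero) []
  pattern node l r = op (inj₂ (suc zero)) (l ∷ r ∷ [])

  encode : ∀ {Γ} → Tree → T.Term Γ tree
  encode nil     = leaf
  encode (l · r) = node (encode l) (encode r)

  trees : ℕ → List Kind⁺
  trees n = replicate n tree

  variable∈ : ∀ {n} → Fin n → tree ∈ trees n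
  variable∈ zero    = here refl
  variable∈ (suc i) = there (variable∈ i)

  compile : ∀ {n} → Pattern n → T.Term (trees n) tree
  compile (var i) = var (variable∈ i)
  compile (con t) = encode t
  compile (p · q) = node (compile p) (compile q)

  proves : ∀ {Γ} → T.Term Γ tree → T.Atom Γ
  proves = mem (inj₂ zero)

  sentence : Clause → T.Sentence
  sentence c = record
    { vars       = trees (arity c)
    ; conditions = map (proves ∘ compile) (premises c)
    ; conclusion = proves (compile (head c))
    }

  X : Extension 𝓡
  X = record { signatureExtension = treeSignature ; newAxioms = map sentence Π }

  𝓡⁺ : RewriteTheory
  𝓡⁺ = Extension.extendedTheory X

  module N = Rewriting 𝓡⁺
  open N using (Holds; ax; ≐-refl; ≐-sym; ≐-trans; ≐-cong; ≐-mem)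

  -- The algebra with the old terms in the old kinds and trees in the new one.

  Carrier : Kind⁺ → Set
  Carrier (inj₁ k) = Ground k
  Carrier (inj₂ _) = Tree

  mutual
    eval : ∀ {k} → T.Ground k → Carrier k
    eval (op (inj₁ f) ts) = O.op f (evals _ ts)
    eval leaf             = nil
    eval (node l r)       = eval l · eval r

    evals : ∀ ks → All T.Ground (map inj₁ ks) → All Ground ks
    evals []       []       = []
    evals (k ∷ ks) (t ∷ ts) = eval t ∷ evals ks ts

  evalsᵗ : ∀ {n} → All T.Ground (trees n) → Vec Tree n
  evalsᵗ {ℕ.zero}  []       = []
  evalsᵗ {ℕ.suc n} (t ∷ ts) = eval t ∷ evalsᵗ ts

  quot : ∀ {k} → Carrier k → T.Ground k
  quot {inj₁ _} = term
  quot {tree}   = encode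

  mutual
    -- The new operators build only trees, so a ground term of an old kind contains old operators
    -- only. Absence of junk therefore holds even up to syntactic equality.
    quot-eval : ∀ {k} (t : T.Ground k) → quot (eval t) ≡ t
    quot-eval (op (inj₁ f) ts) = cong (op (inj₁ f)) (terms-evals _ ts)
    quot-eval leaf             = refl
    quot-eval (node l r)       = cong₂ node (quot-eval l) (quot-eval r)

    terms-evals : ∀ ks (ts : All T.Ground (map inj₁ ks)) → terms (evals ks ts) ≡ ts
    terms-evals []       []       = refl
    terms-evals (k ∷ ks) (t ∷ ts) = cong₂ _∷_ (quot-eval t) (terms-evals ks ts)

  eval-encode : ∀ t → eval (encode t) ≡ t
  eval-encode nil     = refl
  eval-encode (l · r) = cong₂ _·_ (eval-encode l) (eval-encode r)

  encode-[] : ∀ {Γ Δ} t (σ : T.Sub Γ Δ) → encode t [ σ ] ≡ encode t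
  encode-[] nil     σ = refl
  encode-[] (l · r) σ = cong₂ node (encode-[] l σ) (encode-[] r σ)

  eval-lookup : ∀ {Γ k} (x : k ∈ Γ) σ →
    eval (All.lookup σ (∈-map⁺ inj₁ x)) ≡ All.lookup (evals Γ σ) x
  eval-lookup (here refl) (t ∷ σ) = refl
  eval-lookup (there x)   (t ∷ σ) = eval-lookup x σ

  mutual
    eval-term : ∀ {Γ k} (t : Term Γ k) σ → eval (term t [ σ ]) ≡ t O.[ evals Γ σ ]
    eval-term (O.var x)   σ = eval-lookup x σ
    eval-term (O.op f ts) σ = cong (O.op f) (evals-terms ts σ)

    evals-terms : ∀ {Γ ks} (ts : All (Term Γ) ks) σ →
      evals ks (terms ts T.[ σ ]*) ≡ ts O.[ evals Γ σ ]*
    evals-terms []       σ = refl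
    evals-terms (t ∷ ts) σ = cong₂ _∷_ (eval-term t σ) (evals-terms ts σ)

  mutual
    eval-quot : ∀ {k} (t : Ground k) → eval (term t) ≡ t
    eval-quot (O.op f ts) = cong (O.op f) (evals-quot ts)

    evals-quot : ∀ {ks} (ts : All Ground ks) → evals ks (terms ts) ≡ ts
    evals-quot []       = refl
    evals-quot (t ∷ ts) = cong₂ _∷_ (eval-quot t) (evals-quot ts)

  lookup-terms : ∀ {Γ Δ k} (x : k ∈ Γ) (σ : O.Sub Γ Δ) →
    term (All.lookup σ x) ≡ All.lookup (terms σ) (∈-map⁺ inj₁ x)
  lookup-terms (here refl) (t ∷ σ) = refl
  lookup-terms (there x)   (t ∷ σ) = lookup-terms x σ

  mutual
    term-[] : ∀ {Γ Δ k} (t : Term Γ k) (σ : O.Sub Γ Δ) → term (t O.[ σ ]) ≡ term t [ terms σ ]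
    term-[] (O.var x)   σ = lookup-terms x σ
    term-[] (O.op f ts) σ = cong (op (inj₁ f)) (terms-[] ts σ)

    terms-[] : ∀ {Γ Δ ks} (ts : All (Term Γ) ks) (σ : O.Sub Γ Δ) →
      terms (ts O.[ σ ]*) ≡ terms ts T.[ terms σ ]*
    terms-[] []       σ = refl
    terms-[] (t ∷ ts) σ = cong₂ _∷_ (term-[] t σ) (terms-[] ts σ)

  atomic-[] : ∀ {Γ} a (σ : O.GSub Γ) → atomic (a O.[ σ ]ᵃ) ≡ atomic a [ terms σ ]ᵃ
  atomic-[] (t O.≐ u)   σ = cong₂ _≐_ (term-[] t σ) (term-[] u σ)
  atomic-[] (O.mem s t) σ = cong (mem (inj₁ s)) (term-[] t σ)

  eval-variable : ∀ {n} (i : Fin n) (σ : All T.Ground (trees n)) →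
    eval (All.lookup σ (variable∈ i)) ≡ Vec.lookup (evalsᵗ σ) i
  eval-variable zero    (t ∷ σ) = refl
  eval-variable (suc i) (t ∷ σ) = eval-variable i σ

  eval-compile : ∀ {n} (p : Pattern n) (σ : All T.Ground (trees n)) →
    eval (compile p [ σ ]) ≡ p ⟨ evalsᵗ σ ⟩
  eval-compile (var i) σ = eval-variable i σ
  eval-compile (con t) σ = trans (cong eval (encode-[] t σ)) (eval-encode t)
  eval-compile (p · q) σ = cong₂ _·_ (eval-compile p σ) (eval-compile q σ)

  -- Deduction in the extension and in the old theory

  mutual
    holds⁺ : ∀ {a} → O.Holds a → Holds (atomic a)
    holds⁺ (O.ax a σ cs) =
      subst Holds (sym (atomic-[] (O.Sentence.conclusion (axiom a)) σ))
        (ax (inj₁ a) (terms σ) (all-holds⁺ σ cs))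
    holds⁺ O.≐-refl        = ≐-refl
    holds⁺ (O.≐-sym h)     = ≐-sym (holds⁺ h)
    holds⁺ (O.≐-trans h i) = ≐-trans (holds⁺ h) (holds⁺ i)
    holds⁺ (O.≐-cong f {ts} {us} hs) = ≐-cong (inj₁ f) (cong⁺ ts us (λ x → holds⁺ (hs x)))
    holds⁺ (O.≐-mem h i)   = ≐-mem (holds⁺ h) (holds⁺ i)

    all-holds⁺ : ∀ {Γ} (σ : O.GSub Γ) {as} → All (λ a → O.Holds (a O.[ σ ]ᵃ)) as →
      All (λ a → Holds (a [ terms σ ]ᵃ)) (map atomic as)
    all-holds⁺ σ []                 = []
    all-holds⁺ σ (_∷_ {x = a} h hs) = subst Holds (atomic-[] a σ) (holds⁺ h) ∷ all-holds⁺ σ hs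

    cong⁺ : ∀ {ks} (ts us : All Ground ks) →
      (∀ {k} (x : k ∈ ks) → Holds (term (All.lookup ts x) ≐ term (All.lookup us x))) →
      ∀ {k} (x : k ∈ map inj₁ ks) → Holds (All.lookup (terms ts) x ≐ All.lookup (terms us) x)
    cong⁺ (t ∷ ts) (u ∷ us) hs (here refl) = hs (here refl)
    cong⁺ (t ∷ ts) (u ∷ us) hs (there x)   = cong⁺ ts us (λ y → hs (there y)) x

  -- Atoms of old kinds are read as old deduction, so that soundness yields conservativity. Equality
  -- of trees is identity, as no clause concludes an equation, and the new sort is derivability from
  -- `Π`.
  Meaning : T.Atom [] → Set
  Meaning (_≐_ {inj₁ k} t u) = eval t O.≈ eval u
  Meaning (_≐_ {tree} t u)   = eval t ≡ eval u
  Meaning (mem (inj₁ s) t)   = O.Holds (O.mem s (eval t))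
  Meaning (mem (inj₂ _) t)   = Π ⊩ eval t

  meaning-atomic : ∀ {Γ} a σ → Meaning (atomic a [ σ ]ᵃ) ≡ O.Holds (a O.[ evals Γ σ ]ᵃ)
  meaning-atomic (t O.≐ u)   σ = cong₂ (λ t u → O.Holds (t O.≐ u)) (eval-term t σ) (eval-term u σ)
  meaning-atomic (O.mem s t) σ = cong (λ t → O.Holds (O.mem s t)) (eval-term t σ)

  all-meaning : ∀ {Γ} σ {as} → All (λ a → Meaning (a [ σ ]ᵃ)) (map atomic as) →
    All (λ a → O.Holds (a O.[ evals Γ σ ]ᵃ)) as
  all-meaning σ {as = []}     []       = []
  all-meaning σ {as = a ∷ as} (m ∷ ms) = subst (λ M → M) (meaning-atomic a σ) m ∷ all-meaning σ ms

  Valid : T.Sentence → Set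
  Valid φ = ∀ σ → All (λ c → Meaning (c [ σ ]ᵃ)) conditions → Meaning (conclusion [ σ ]ᵃ)
    where open T.Sentence φ

  sentence-valid : ∀ {c} → c ∈ Π → Valid (sentence c)
  sentence-valid {c} c∈Π σ ms = subst (Π ⊩_) (sym (eval-compile (head c) σ))
    (by c∈Π (evalsᵗ σ)
      (All.map (λ {p} → subst (Π ⊩_) (eval-compile p σ)) (All.map⁻ {f = proves ∘ compile} ms)))

  new-valid : All Valid (map sentence Π)
  new-valid = All.map⁺ {f = sentence} (All.tabulate sentence-valid)

  ≐-meaning-refl : ∀ {k} (t : T.Ground k) → Meaning (t ≐ t)
  ≐-meaning-refl {inj₁ _} t = O.≐-refl
  ≐-meaning-refl {tree}   t = refl

  ≐-meaning-sym : ∀ {k} {t u : T.Ground k} → Meaning (t ≐ u) → Meaning (u ≐ t)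
  ≐-meaning-sym {inj₁ _} = O.≐-sym
  ≐-meaning-sym {tree}   = sym

  ≐-meaning-trans : ∀ {k} {t u v : T.Ground k} →
    Meaning (t ≐ u) → Meaning (u ≐ v) → Meaning (t ≐ v)
  ≐-meaning-trans {inj₁ _} = O.≐-trans
  ≐-meaning-trans {tree}   = trans

  mutual
    -- Gives conservativity over the old theory and, for the new sort, that only trees derivable
    -- from `Π` satisfy it.
    sound : ∀ {a} → Holds a → Meaning a
    sound (ax (inj₁ a) σ cs) =
      subst (λ M → M) (sym (meaning-atomic (O.Sentence.conclusion (axiom a)) σ))
        (O.ax a (evals _ σ) (all-meaning σ (sounds σ cs)))
    sound (ax (inj₂ i) σ cs) = All.lookup new-valid (∈-lookup i) σ (sounds σ cs)
    sound {t ≐ _} ≐-refl = ≐-meaning-refl t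
    sound {t ≐ u} (≐-sym h) = ≐-meaning-sym {t = u} {t} (sound h)
    sound {t ≐ v} (≐-trans {u = u} h i) = ≐-meaning-trans {t = t} {u} {v} (sound h) (sound i)
    sound (≐-cong (inj₁ f) {ts} {us} hs) = O.≐-cong f λ x →
      subst₂ O._≈_ (eval-lookup x ts) (eval-lookup x us) (sound (hs (∈-map⁺ inj₁ x)))
    sound (≐-cong (inj₂ zero) {[]} {[]} hs) = refl
    sound (≐-cong (inj₂ (suc zero)) {_ ∷ _ ∷ []} {_ ∷ _ ∷ []} hs) =
      cong₂ _·_ (sound (hs (here refl))) (sound (hs (there (here refl))))
    sound (≐-mem {inj₁ s} h i) = O.≐-mem (sound h) (sound i)
    sound (≐-mem {inj₂ s} h i) = subst (Π ⊩_) (sound h) (sound i)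

    sounds : ∀ {Γ} (σ : T.GSub Γ) {as} → All (λ a → Holds (a [ σ ]ᵃ)) as →
      All (λ a → Meaning (a [ σ ]ᵃ)) as
    sounds σ []       = []
    sounds σ (h ∷ hs) = sound h ∷ sounds σ hs

  new-axiom : ∀ {φ} → φ ∈ map sentence Π → let open T.Sentence φ in
    ∀ σ → All (λ c → Holds (c [ σ ]ᵃ)) conditions → Holds (conclusion [ σ ]ᵃ)
  -- New axioms are indexed by their position in the list, so the membership proof is turned into
  -- that position.
  new-axiom φ∈ with index φ∈ | lookup-index φ∈
  ... | i | refl = ax (inj₂ i)

  encodes : ∀ {n} → Vec Tree n → All T.Ground (trees n)
  encodes []      = []
  encodes (t ∷ σ) = encode t ∷ encodes σ

  encode-variable : ∀ {n} (i : Fin n) (σ : Vec Tree n) →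
    All.lookup (encodes σ) (variable∈ i) ≡ encode (Vec.lookup σ i)
  encode-variable zero    (t ∷ σ) = refl
  encode-variable (suc i) (t ∷ σ) = encode-variable i σ

  compile-⟨⟩ : ∀ {n} (p : Pattern n) (σ : Vec Tree n) →
    compile p [ encodes σ ] ≡ encode (p ⟨ σ ⟩)
  compile-⟨⟩ (var i) σ = encode-variable i σ
  compile-⟨⟩ (con t) σ = encode-[] t (encodes σ)
  compile-⟨⟩ (p · q) σ = cong₂ node (compile-⟨⟩ p σ) (compile-⟨⟩ q σ)

  mutual
    complete : ∀ {t} → Π ⊩ t → Holds (proves (encode t))
    complete (by {c} c∈Π σ ds) = subst (Holds ∘ proves) (compile-⟨⟩ (head c) σ)
      (new-axiom (∈-map⁺ sentence c∈Π) (encodes σ) (completes σ ds))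

    completes : ∀ {n} (σ : Vec Tree n) {ps} → All (λ p → Π ⊩ p ⟨ σ ⟩) ps →
      All (λ a → Holds (a [ encodes σ ]ᵃ)) (map (proves ∘ compile) ps)
    completes σ []                 = []
    completes σ (_∷_ {x = p} d ds) =
      subst (Holds ∘ proves) (sym (compile-⟨⟩ p σ)) (complete d) ∷ completes σ ds

  ≈-reflexive : ∀ {k} {t u : T.Ground k} → t ≡ u → t N.≈ u
  ≈-reflexive refl = ≐-refl

  -- Preservation and reflection of rewriting

  hole : ∀ {j k} → O.Hole j k → T.Hole (inj₁ j) (inj₁ k)
  hole O.□             = T.□
  hole (O.op f ts x c) = T.op (inj₁ f) (terms ts) (∈-map⁺ inj₁ x) (hole c)

  hole-admits : ∀ {w j k} {c : O.Hole j k} → O.Admits w c → N.Admits w (hole c)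
  hole-admits O.anywhere = N.anywhere
  hole-admits O.root     = N.root

  terms-≔ : ∀ {ks k} (ts : All Ground ks) (x : k ∈ ks) u →
    terms (ts [ x ]≔ u) ≡ terms ts [ ∈-map⁺ inj₁ x ]≔ term u
  terms-≔ (t ∷ ts) (here refl) u = refl
  terms-≔ (t ∷ ts) (there x)   u = cong (term t ∷_) (terms-≔ ts x u)

  term-plug : ∀ {j k} (c : O.Hole j k) t → term (O.plug c t) ≡ T.plug (hole c) (term t)
  term-plug O.□             t = refl
  term-plug (O.op f ts x c) t = cong (op (inj₁ f)) (trans (terms-≔ ts x (O.plug c t))
    (cong (terms ts [ ∈-map⁺ inj₁ x ]≔_) (term-plug c t)))

  term-redex : ∀ {Γ j k} (c : O.Hole j k) (l : Term Γ j) σ →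
    term (O.plug c (l O.[ σ ])) ≡ T.plug (hole c) (term l [ terms σ ])
  term-redex c l σ = trans (term-plug c (l O.[ σ ])) (cong (T.plug (hole c)) (term-[] l σ))

  mutual
    rewrite⁺ : ∀ {w k} {t u : Ground k} → O.Rewrite w t u → N.Rewrite w (term t) (term u)
    rewrite⁺ (O.rewrite-with i c adm σ e cs e′) =
      N.rewrite-with i (hole c) (hole-admits adm) (terms σ)
        (subst (term _ N.≈_) (term-redex c lhs σ) (holds⁺ e))
        (satisfies⁺ σ cs)
        (subst (N._≈ term _) (term-redex c rhs σ) (holds⁺ e′))
      where open O.Rule (rule i)

    satisfies⁺ : ∀ {Γ} (σ : O.GSub Γ) {C} → All (O.Satisfies σ) C →
      All (N.Satisfies (terms σ)) (map (Embedding.fragment treeSignature) C)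
    satisfies⁺ σ []                      = []
    satisfies⁺ σ (O.atom {a = a} h ∷ cs) =
      N.atom (subst Holds (atomic-[] a σ) (holds⁺ h)) ∷ satisfies⁺ σ cs
    satisfies⁺ σ (O._⇒_ {l = l} {p} rs e ∷ cs) =
      (subst (λ t → Star (N.Rewrite anywhere) t _) (term-[] l σ) (rewrites⁺ rs) N.⇒
       subst (_ N.≈_) (term-[] p σ) (holds⁺ e)) ∷ satisfies⁺ σ cs

    rewrites⁺ : ∀ {w k} {t u : Ground k} → Star (O.Rewrite w) t u →
      Star (N.Rewrite w) (term t) (term u)
    rewrites⁺ ε        = ε
    rewrites⁺ (r ◅ rs) = rewrite⁺ r ◅ rewrites⁺ rs

  -- A view that recovers the position in the old list from a position in its image.
  data Old {ks : List Kind} : ∀ {k : Kind⁺} → k ∈ map inj₁ ks → Set where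
    old : ∀ {k} (x : k ∈ ks) → Old (∈-map⁺ inj₁ x)

  old? : ∀ {ks} {k : Kind⁺} (x : k ∈ map inj₁ ks) → Old x
  old? {_ ∷ _} (here refl) = old (here refl)
  old? {_ ∷ _} (there x) with old? x
  ... | old y = old (there y)

  evals-≔ : ∀ {ks k} ts (x : k ∈ ks) u →
    evals ks (ts [ ∈-map⁺ inj₁ x ]≔ u) ≡ evals ks ts [ x ]≔ eval u
  evals-≔ (t ∷ ts) (here refl) u = refl
  evals-≔ (t ∷ ts) (there x)   u = cong (eval t ∷_) (evals-≔ ts x u)

  -- Information is recorded for contexts with a result of an old kind. Old operators have arguments
  -- of old kinds only, so the induction stays among such contexts.
  OldHole : ∀ {j k} → T.Hole (inj₁ j) k → Set
  OldHole {j} {inj₁ k} c =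
    Σ[ d ∈ O.Hole j k ] (∀ t → eval (T.plug c t) ≡ O.plug d (eval t)) ×
                        (∀ {w} → N.Admits w c → O.Admits w d)
  OldHole {j} {tree} c = ⊤

  old-hole : ∀ {j k} (c : T.Hole (inj₁ j) k) → OldHole c
  old-hole T.□ = O.□ , (λ _ → refl) , λ { N.anywhere → O.anywhere ; N.root → O.root }
  old-hole (T.op (inj₁ f) ts x c) with old? x
  ... | old y with old-hole c
  ... | d , e , _ =
    O.op f (evals _ ts) y d ,
    (λ t → cong (O.op f) (trans (evals-≔ ts y (T.plug c t)) (cong (evals _ ts [ y ]≔_) (e t)))) ,
    λ { N.anywhere → O.anywhere }
  old-hole (T.op (inj₂ _) ts x c) = tt

  mutual
    -- Every rule of the extension is an old one, so evaluating its context, substitution and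
    -- conditions gives an old rewrite.
    rewrite⁻ : ∀ {w k} {t u : T.Ground (inj₁ k)} → N.Rewrite w t u → O.Rewrite w (eval t) (eval u)
    rewrite⁻ (N.rewrite-with i c adm σ e cs e′) with old-hole c
    ... | d , plugged , admits =
      O.rewrite-with i d (admits adm) (evals _ σ)
        (subst (_ O.≈_) (trans (plugged _) (cong (O.plug d) (eval-term lhs σ))) (sound e))
        (satisfies⁻ σ cs)
        (subst (O._≈ _) (trans (plugged _) (cong (O.plug d) (eval-term rhs σ))) (sound e′))
      where open O.Rule (rule i)

    satisfies⁻ : ∀ {Γ} σ {C} → All (N.Satisfies σ) (map (Embedding.fragment treeSignature) C) →
      All (O.Satisfies (evals Γ σ)) C
    satisfies⁻ σ {[]} [] = []
    satisfies⁻ σ {O.atom a ∷ C} (N.atom h ∷ cs) =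
      O.atom (subst (λ M → M) (meaning-atomic a σ) (sound h)) ∷ satisfies⁻ σ cs
    satisfies⁻ σ {(l O.⇒ p) ∷ C} ((rs N.⇒ e) ∷ cs) =
      (subst (λ t → Star (O.Rewrite anywhere) t _) (eval-term l σ) (rewrites⁻ rs) O.⇒
       subst (_ O.≈_) (eval-term p σ) (sound e)) ∷ satisfies⁻ σ cs

    rewrites⁻ : ∀ {w k} {t u : T.Ground (inj₁ k)} → Star (N.Rewrite w) t u →
      Star (O.Rewrite w) (eval t) (eval u)
    rewrites⁻ ε        = ε
    rewrites⁻ (r ◅ rs) = rewrite⁻ r ◅ rewrites⁻ rs

  protecting : Extension.Protecting X
  protecting = record
    { no-junk   = λ t → eval t , ≈-reflexive (sym (quot-eval t))
    ; equality  = λ t u → mk⇔ holds⁺ λ h →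
                    subst₂ O._≈_ (eval-quot t) (eval-quot u) (sound h)
    ; sorting   = λ s t → mk⇔ holds⁺ λ h →
                    subst (O.Holds ∘ O.mem s) (eval-quot t) (sound h)
    ; rewriting = λ t u → mk⇔ rewrite⁺ λ r →
                    subst₂ O._⟶_ (eval-quot t) (eval-quot u) (rewrite⁻ r)
    }

-- Strategies for automata defined by Horn programs

-- A single predicate on trees serves for several relations, told apart by the
-- left subtree.

nextᵖ : ∀ {n} → Pattern n → Pattern n → Pattern n → Pattern n
nextᵖ a s t = con nil · a · s · t

endᵖ : ∀ {n} → Pattern n → Pattern n → Pattern n
endᵖ a s = con (nil · nil) · a · s

nextᵗ : Tree → Tree → Tree → Tree
nextᵗ a s t = nil · a · s · t

endᵗ : Tree → Tree → Tree
endᵗ a s = (nil · nil) · a · s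

module Automaton (Π : List Clause) {n : ℕ} (label : Fin n → Tree) where

  Next : Fin n → Tree → Tree → Set
  Next a s t = Π ⊩ nextᵗ (label a) s t

  End : Fin n → Tree → Set
  End a s = Π ⊩ endᵗ (label a) s

  -- An execution with n states has n - 1 rewrites: the last letter is tested but not followed by a
  -- rewrite, so `End` carries a letter of its own.
  data Path (s : Tree) : List (Fin n) → Set where
    done : ∀ {a} → End a s → Path s (a ∷ [])
    _∷_ : ∀ {a t v} → Next a s t → Path t v → Path s (a ∷ v)

  Pathω : Tree → (ℕ → Fin n) → Set
  Pathω s v = Σ[ r ∈ (ℕ → Tree) ] r 0 ≡ s × (∀ i → Next (v i) (r i) (r (suc i)))

module TraceStrategy (𝓡 : RewriteTheory) (Π : List Clause) {n : ℕ} (label : Fin n → Tree)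
  (letter : Fin n → Rewriting.State 𝓡) (initial : Tree) where

  open HornExtension 𝓡 Π
  open Automaton Π label
  open N hiding (_⇒_; step)
  private module O = Rewriting 𝓡
  module S = Strategies 𝓡⁺

  letterTerm : ∀ {Γ} (a : Fin n) → Term Γ (inj₁ (proj₁ (letter a)))
  letterTerm a = weaken (Extension.Embed.term X (proj₂ (letter a)))

  params : Fin 1 → Ctx
  params _ = trees 1

  loop : ∀ {Γ} → Term Γ tree → S.Strat params Γ
  loop e = S.call zero (e ∷ [])

  -- The rewrite is arbitrary; the next letter is enforced by the match after the following call.
  -- Being a tail call, that call replaces the bindings on the stack.
  emit : ∀ {Γ} → Fin n → Term Γ tree → S.Strat params Γ
  emit a e = S.match [] (letterTerm a) [] S.⨟ S.all anywhere S.⨟ loop e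

  -- The pattern binds the current state only. In `emission` the next state is left open by it, so
  -- the call guesses any value satisfying the condition.
  emission final : Fin n → S.Definition params zero
  emission a = record
    { vars      = trees 2
    ; patterns  = compile {2} (var zero) ∷ []
    ; condition = proves (compile (nextᵖ (con (label a)) (var zero) (var (suc zero)))) ∷ []
    ; body      = emit a (compile {2} (var (suc zero)))
    }
  final a = record
    { vars      = trees 1
    ; patterns  = compile {1} (var zero) ∷ []
    ; condition = proves (compile (endᵖ (con (label a)) (var zero))) ∷ []
    ; body      = S.match [] (letterTerm a) []
    }

  M : S.StrategyModule
  M = record
    { params      = params
    ; definitions = λ { zero → map emission (allFin n) ++ map final (allFin n) }
    }

  open Semantics 𝓡⁺ M

  α : Strat []
  α = loop (encode initial)

  mutual
    weaken-[] : ∀ {Γ k} (t : Ground k) (σ : GSub Γ) → weaken {Γ} t [ σ ] ≡ t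
    weaken-[] (op f ts) σ = cong (op f) (weaken-[]* ts σ)

    weaken-[]* : ∀ {Γ ks} (ts : All Ground ks) (σ : GSub Γ) → (ts [ [] ]*) [ σ ]* ≡ ts
    weaken-[]* []       σ = refl
    weaken-[]* (t ∷ ts) σ = cong₂ _∷_ (weaken-[] t σ) (weaken-[]* ts σ)

  embed : O.State → State
  embed = Extension.embedState X

  data Shows {k} (t : Ground k) (a : Fin n) : Set where
    shows : (k , t) ≋ embed (letter a) → Shows t a

  -- The stacks possible below a call: empty at first, and a single substitution ever after, because
  -- calls are tail calls.
  data Bottom : ∀ {Γ} → Stack Γ → Set where
    empty : Bottom ε
    bound : ∀ {Γ} {σ : GSub Γ} → Bottom (σ ▸ ε)

  -- The states between two system transitions of the strategy, while the current
  -- term is t and the automaton is in state s.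

  data Phase {k} (t : Ground k) (s : Tree) : XS k → Set where
    calling : ∀ {Γ e} {stk : Stack Γ} → Bottom stk → eval (e [ vctx stk ]) ≡ s →
              Phase t s (t ＠ loop e ▹ stk)
    chosen  : ∀ {Γ e a} {σ : GSub Γ} → Next a s (eval (e [ σ ])) →
              Phase t s (t ＠ emit a e ▹ σ ▸ ε)
    testing : ∀ {Γ e a} {σ : GSub Γ} → Next a s (eval (e [ σ ])) →
              Phase t s (t ＠ S.match [] (letterTerm a) [] ▹ (S.all anywhere S.⨟ loop e) ▹ σ ▸ ε)
    tested  : ∀ {Γ e a} {σ : GSub Γ} → Next a s (eval (e [ σ ])) → Shows t a →
              Phase t s (t ＠ (S.all anywhere S.⨟ loop e) ▹ σ ▸ ε)
    ready   : ∀ {Γ e a} {σ : GSub Γ} → Next a s (eval (e [ σ ])) → Shows t a →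
              Phase t s (t ＠ S.all anywhere ▹ loop e ▹ σ ▸ ε)
    ending  : ∀ {Γ a} {σ : GSub Γ} → End a s →
              Phase t s (t ＠ S.match [] (letterTerm a) [] ▹ σ ▸ ε)
    leaving : ∀ {Γ a} {σ : GSub Γ} → End a s → Shows t a → Phase t s (t ＠ σ ▸ ε)
    ended   : ∀ {a} → End a s → Shows t a → Phase t s (solution t)

  matched : ∀ {k Γ a} {t : Ground k} (σ : GSub Γ) (e : k ≡ inj₁ (proj₁ (letter a))) →
    subst Ground e t ≈ letterTerm a [ σ ] → Shows t a
  matched {a = a} σ refl t≈ = shows (same (subst (_ ≈_) (weaken-[] _ σ) t≈))

  -- The argument matches and the condition holds modulo the extended theory; `sound` turns this
  -- into an equality of trees and a derivation from `Π`.
  called : ∀ {k Γ} {t : Ground k} {s} {e : Term Γ tree} {stk : Stack Γ} {d} →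
    Bottom stk → eval (e [ vctx stk ]) ≡ s →
    d ∈ S.StrategyModule.definitions M zero → let open S.Definition d in
    ∀ (σ : GSub vars) →
    (∀ {j} (x : j ∈ params zero) →
      All.lookup patterns x [ σ ] ≈ All.lookup {P = Term Γ} (e ∷ []) x [ vctx stk ]) →
    All (λ c → Holds (c [ σ ]ᵃ)) condition →
    Phase t s (t ＠ body ▹ enter σ stk)
  called {t = t} {s} {e} {stk} bottom refl d∈ σ args conds with ∈-++⁻ (map emission (allFin n)) d∈
  ... | inj₁ d∈₁ with ∈-map⁻ emission d∈₁
  ...   | a , _ , refl with σ | conds | args (here refl)
  ...     | x ∷ y ∷ [] | c ∷ [] | arg = entered bottom
    where
    chosenNext : Next a s (eval y)
    chosenNext = subst (λ z → Next a z (eval y)) (sound arg)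
      (subst (λ z → Π ⊩ nextᵗ z (eval x) (eval y))
        (eval-compile (con (label a)) (x ∷ y ∷ [])) (sound c))
    entered : ∀ {Γ} {stk : Stack Γ} → Bottom stk →
      Phase t s (t ＠ emit a (compile {2} (var (suc zero))) ▹ enter (x ∷ y ∷ []) stk)
    entered empty = chosen chosenNext
    entered bound = chosen chosenNext
  called {t = t} {s} {e} {stk} bottom refl d∈ σ args conds | inj₂ d∈₂ with ∈-map⁻ final d∈₂
  ...   | a , _ , refl with σ | conds | args (here refl)
  ...     | x ∷ [] | c ∷ [] | arg = entered bottom
    where
    chosenEnd : End a s
    chosenEnd = subst (End a) (sound arg)
      (subst (λ z → Π ⊩ endᵗ z (eval x)) (eval-compile (con (label a)) (x ∷ [])) (sound c))
    entered : ∀ {Γ} {stk : Stack Γ} → Bottom stk →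
      Phase t s (t ＠ S.match [] (letterTerm a) [] ▹ enter (x ∷ []) stk)
    entered empty = ending chosenEnd
    entered bound = ending chosenEnd

  -- The phases are closed under control transitions: a match on a wrong letter blocks, `ready`
  -- allows a system transition only, and `ended` allows none.
  phase-control : ∀ {k} {t : Ground k} {s q q′} → Phase t s q → q →c q′ → Phase t s q′
  phase-control (calling b e) (call {d = d} d∈ σ args conds) = called {d = d} b e d∈ σ args conds
  phase-control (chosen x) seq = testing x
  phase-control (testing {σ = σ} x) (match [] m _) = tested x (matched σ refl m)
  phase-control (tested x m) seq = ready x m
  phase-control (ending {σ = σ} x) (match [] m _) = leaving x (matched σ refl m)
  phase-control (leaving x m) pop = ended x m

  phase-controls : ∀ {k} {t : Ground k} {s q q′} → Phase t s q → q →c* q′ → Phase t s q′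
  phase-controls p ε        = p
  phase-controls p (c ◅ cs) = phase-controls (phase-control p c) cs

  data Loop {k} (s : Tree) : XS k → Set where
    looping : ∀ {Γ e t} {stk : Stack Γ} → Bottom stk → eval (e [ vctx stk ]) ≡ s →
              Loop s (t ＠ loop e ▹ stk)

  -- `ready` is the only phase with a system transition, so one `↠` comprises one call, one test and
  -- one rewrite, and ends at the next call.
  loop-step : ∀ {k} {s} {q q′ : XS k} → Loop s q → q ↠ q′ →
    ∃[ a ] ∃[ s′ ] Shows (cterm q) a × Next a s s′ × Loop s′ q′
  loop-step (looping b e) (p , cs , st) with phase-controls (calling b e) cs
  loop-step (looping b e) (p , cs , all _) | ready x m = _ , _ , m , x , looping bound refl

  loop-end : ∀ {k} {s} {q : XS k} {t} → Loop s q → q →c* solution t →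
    ∃[ a ] Shows (cterm q) a × End a s
  loop-end (looping b e) cs with phase-controls (calling b e) cs
  ... | ended x m = _ , m , x

  loop-path : ∀ {k s} {q : XS k} {qs} → Loop s q → Ex* q qs →
    ∃[ v ] Path s v × Pointwise (λ q a → Shows (cterm q) a) qs v
  loop-path l (end cs) with loop-end l cs
  ... | a , m , x = a ∷ [] , done x , m ∷ []
  loop-path l (st ∷ ex) with loop-step l st
  ... | a , _ , m , x , l′ with loop-path l′ ex
  ...   | v , p , ms = a ∷ v , x ∷ p , m ∷ ms

  module _ {k : Kind} (q : ℕ → XS k) (steps : ∀ i → q i ↠ q (suc i))
    (start : Loop initial (q 0)) where

    looped : ∀ i → ∃[ s ] Loop s (q i)
    looped zero    = initial , start
    looped (suc i) = let _ , l = looped i ; _ , s , _ , _ , l′ = loop-step l (steps i) in s , l′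

    loop-pathω : ∃[ v ] Pathω initial v × (∀ i → Shows (cterm (q i)) (v i))
    loop-pathω =
      (λ i → proj₁ (move i)) ,
      ((λ i → proj₁ (looped i)) , refl , (λ i → let _ , _ , _ , x , _ = move i in x)) ,
      (λ i → let _ , _ , m , _ , _ = move i in m)
      where move = λ i → loop-step (proj₂ (looped i)) (steps i)

  -- Executions of the strategy along a path

  loop-call : ∀ {k Γ} {t : Ground k} {s} {e : Term Γ tree} {stk : Stack Γ} {d} → Bottom stk →
    eval (e [ vctx stk ]) ≡ s →
    d ∈ S.StrategyModule.definitions M zero → let open S.Definition d in
    ∀ (σ : GSub vars) →
    All.lookup patterns (here refl) [ σ ] ≡ encode s →
    All (λ c → Holds (c [ σ ]ᵃ)) condition →
    (t ＠ loop e ▹ stk) →c (t ＠ body ▹ σ ▸ ε)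
  -- The two stacks are treated separately because `enter` computes only on a known stack.
  loop-call empty refl d∈ σ arg conds =
    call d∈ σ (λ { (here refl) → ≈-reflexive (trans arg (quot-eval _)) }) conds
  loop-call bound refl d∈ σ arg conds =
    call d∈ σ (λ { (here refl) → ≈-reflexive (trans arg (quot-eval _)) }) conds

  emits : ∀ {k s s′ a} {q : XS k} {t} → Loop s q → Next a s s′ → Shows (cterm q) a →
    cterm q ⟶ t → ∃[ q′ ] q ↠ q′ × cterm q′ ≡ t × Loop s′ q′
  emits {s = s} {s′} {a} (looping b e) x (shows (same m)) r =
    _ ,
    (_ ,
     loop-call {s = s} b e (∈-++⁺ˡ (∈-map⁺ emission (∈-allFin a))) σ
       refl (condition ∷ []) ◅
     seq ◅
     match [] (subst (_ ≈_) (sym (weaken-[] _ σ)) m) [] ◅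
     seq ◅ ε ,
     all r) ,
    refl ,
    looping bound (eval-encode s′)
    where
    σ = encodes (s ∷ s′ ∷ [])
    condition = subst (Holds ∘ proves)
      (sym (compile-⟨⟩ (nextᵖ (con (label a)) (var zero) (var (suc zero))) (s ∷ s′ ∷ [])))
      (complete x)

  finishes : ∀ {k s a} {q : XS k} → Loop s q → End a s → Shows (cterm q) a →
    q →c* solution (cterm q)
  finishes {s = s} {a} (looping b e) x (shows (same m)) =
    loop-call {s = s} b e (∈-++⁺ʳ (map emission (allFin n)) (∈-map⁺ final (∈-allFin a))) σ
      refl (condition ∷ []) ◅
    match [] (subst (_ ≈_) (sym (weaken-[] _ σ)) m) [] ◅
    pop ◅ ε
    where
    σ = encodes (s ∷ [])
    condition = subst (Holds ∘ proves)
      (sym (compile-⟨⟩ (endᵖ (con (label a)) (var zero)) (s ∷ []))) (complete x)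

  ≋-trans : ∀ {x y z} → x ≋ y → y ≋ z → x ≋ z
  ≋-trans (same h) (same i) = same (≐-trans h i)

  embed-≋⁻ : ∀ {x y} → embed x ≋ embed y → x O.≋ y
  embed-≋⁻ {_ , t} {_ , u} (same h) = O.same (subst₂ O._≈_ (eval-quot t) (eval-quot u) (sound h))

  current-letter : ∀ {k x a} {t : Ground k} → embed x ≋ (k , t) → Shows t a →
    x O.≋ letter a
  current-letter e (shows m) = embed-≋⁻ (≋-trans e m)

  letters : ∀ {k w v} {qs : List (XS k)} →
    Pointwise (λ x q → embed x ≋ (_ , cterm q)) w qs →
    Pointwise (λ q a → Shows (cterm q) a) qs v → Pointwise (λ x a → x O.≋ letter a) w v
  letters []       []       = []
  letters (e ∷ es) (m ∷ ms) = current-letter e m ∷ letters es ms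

  loop-start : ∀ {k} {t : Ground k} → Loop initial (t ＠ α ▹ ε)
  loop-start = looping empty (trans (cong eval (encode-[] initial [])) (eval-encode initial))

  shows-letter : ∀ {k} {t : O.Ground k} {u a} → u ≡ Extension.Embed.term X t →
    (k , t) O.≋ letter a → Shows u a
  shows-letter refl (O.same m) = shows (same (holds⁺ m))

  current-embed : ∀ {k} {t : O.Ground k} {u} → u ≡ Extension.Embed.term X t →
    embed (k , t) ≋ (inj₁ k , u)
  current-embed refl = same ≐-refl

  -- The current term is kept syntactically equal to the embedded representative in the word, so the
  -- rewrites of the word can be replayed.
  path-execution : ∀ {k s w v} {t : O.Ground k} {q : XS (inj₁ k)} → Path s v →
    Pointwise (λ x a → x O.≋ letter a) ((k , t) ∷ w) v → Linked O._⟶ˢ_ ((k , t) ∷ w) →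
    Loop s q → cterm q ≡ Extension.Embed.term X t →
    ∃[ qs ] Ex* q qs × Pointwise (λ x q → embed x ≋ (_ , cterm q)) ((k , t) ∷ w) qs
  path-execution (done x) (m ∷ []) rs l e =
    _ , end (finishes l x (shows-letter e m)) , current-embed e ∷ []
  path-execution (x ∷ p) (m ∷ ms@(_ ∷ _)) (O.step r ∷ rs) l e
    with emits l x (shows-letter e m) (subst (_⟶ _) (sym e) (rewrite⁺ r))
  ... | _ , st , e′ , l′ with path-execution p ms rs l′ e′
  ...   | _ , ex , es = _ , st ∷ ex , current-embed e ∷ es

  module _ {k : O.Kind} {w : ℕ → O.State} {v : ℕ → Fin n} (path : Pathω initial v)
    (ms : ∀ i → w i O.≋ letter (v i)) (rs : ∀ i → w i O.⟶ˢ w (suc i)) where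

    -- Rewriting preserves kinds, so all states of `w` have the kind `k`; this is carried along as
    -- an equation.
    At : ℕ → Set
    At i = Σ[ q ∈ XS (inj₁ k) ] Loop (proj₁ path i) q ×
           Σ[ t ∈ O.Ground k ] w i ≡ (k , t) × cterm q ≡ Extension.Embed.term X t

    following : ∀ {t y} → (k , t) O.⟶ˢ y → Σ[ u ∈ O.Ground k ] y ≡ (k , u) × t O.⟶ u
    following (O.step r) = _ , refl , r

    advance : ∀ i (a : At i) → Σ[ b ∈ At (suc i) ] proj₁ a ↠ proj₁ b
    advance i (q , l , t , w≡ , e)
      with following (subst (O._⟶ˢ w (suc i)) w≡ (rs i))
    ... | u , w′≡ , r
      with emits l (proj₂ (proj₂ path) i) (shows-letter e (subst (O._≋ _) w≡ (ms i)))
             (subst (_⟶ _) (sym e) (rewrite⁺ r))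
    ...   | q′ , st , e′ , l′ = (q′ , l′ , u , w′≡ , e′) , st

    at : At 0 → ∀ i → At i
    at a zero    = a
    at a (suc i) = proj₁ (advance i (at a i))

    execution : (a : At 0) →
      (∀ i → proj₁ (at a i) ↠ proj₁ (at a (suc i))) ×
      (∀ i → embed (w i) ≋ (_ , cterm (proj₁ (at a i))))
    execution a =
      (λ i → proj₂ (advance i (at a i))) ,
      (λ i → let _ , _ , _ , w≡ , e = at a i in
        subst (λ x → embed x ≋ (_ , cterm (proj₁ (at a i)))) (sym w≡) (current-embed e))

  strategy-language : ∀ {L} → L ⊆ᴸ executions 𝓡 →
    (∀ w → Language.finite L w ⇔
      (∃[ v ] Path initial v × Pointwise (λ x a → x O.≋ letter a) w v)) →
    (∀ w → Language.infinite L w ⇔ (∃[ v ] Pathω initial v × (∀ i → w i O.≋ letter (v i)))) →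
    E 𝓡 X M α ≈ᴸ L
  strategy-language {L} (L⊆ , L⊆ω) fin inf = (λ w → mk⇔ to from) , (λ w → mk⇔ toω fromω)
    where
    to : ∀ {w} → Language.finite (E 𝓡 X M α) w → Language.finite L w
    to {w} (_ , _ , _ , ex , es) with loop-path loop-start ex
    ... | v , p , ms = Equivalence.from (fin w) (v , p , letters es ms)

    from : ∀ {w} → Language.finite L w → Language.finite (E 𝓡 X M α) w
    from {[]} x with () ← proj₁ (L⊆ _ x) refl
    from {(k , t) ∷ w} x with Equivalence.to (fin _) x
    ... | v , p , ms =
      k , t , path-execution p ms (proj₂ (L⊆ _ x)) loop-start refl

    toω : ∀ {w} → Language.infinite (E 𝓡 X M α) w → Language.infinite L w
    toω {w} (_ , _ , q , (q₀ , steps) , es)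
      with loop-pathω q steps (subst (Loop initial) (sym q₀) loop-start)
    ... | v , p , ms = Equivalence.from (inf w) (v , p , λ i → current-letter (es i) (ms i))

    fromω : ∀ {w} → Language.infinite L w → Language.infinite (E 𝓡 X M α) w
    fromω {w} x with Equivalence.to (inf w) x | L⊆ω w x
    ... | v , p@(_ , r₀ , _) , ms | rs =
      let a         = _ , subst (λ s → Loop s _) (sym r₀) loop-start , proj₂ (w 0) , refl , refl
          steps , es = execution p ms rs a
      in proj₁ (w 0) , proj₂ (w 0) , (λ i → proj₁ (at p ms rs a i)) , (refl , steps) , es

-- Machine runs on zippers

-- Concatenation of infinitely many finite stretches into one run. The step required after the good
-- configuration makes each stretch nonempty, so the run always progresses.
module Chain {X C : Set} {_⊢_ : C → C → Set} {Good : C → Set}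
  (following : X → X) (at : X → C)
  (stretch : ∀ x → ∃[ g ] Star _⊢_ (at x) g × Good g ×
                   ∃[ c ] g ⊢ c × Star _⊢_ c (at (following x))) (x₀ : X) where

  -- A position within a stretch, with at least one step of it left.

  Pointer : Set
  Pointer = Σ[ x ∈ X ] ∃[ c ] ∃[ d ] c ⊢ d × Star _⊢_ d (at (following x))

  join : ∀ {b c d e} → Star _⊢_ b c → c ⊢ d → Star _⊢_ d e → ∃[ c′ ] b ⊢ c′ × Star _⊢_ c′ e
  join ε        s q = _ , s , q
  join (t ◅ ts) s q = _ , t , ts ◅◅ s ◅ q

  enter : X → Pointer
  enter x = let _ , p , _ , _ , s , q = stretch x in x , at x , join p s q

  advance : Pointer → Pointer
  advance (x , _ , _ , _ , ε)      = enter (following x)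
  advance (x , _ , _ , _ , s ◅ ss) = x , _ , _ , s , ss

  pointer : ℕ → Pointer
  pointer zero    = enter x₀
  pointer (suc i) = advance (pointer i)

  config : Pointer → C
  config (_ , c , _) = c

  run : ℕ → C
  run i = config (pointer i)

  run-step : ∀ i → run i ⊢ run (suc i)
  run-step i with pointer i
  ... | _ , _ , _ , s , ε     = s
  ... | _ , _ , _ , s , _ ◅ _ = s

  exits : ∀ i {x c d} {s : c ⊢ d} p → pointer i ≡ (x , c , d , s , p) →
    ∃[ j ] i ≤ j × pointer j ≡ enter (following x)
  exits i ε        e = suc i , n≤1+n i , cong advance e
  exits i (_ ◅ p) e =
    let j , i<j , e′ = exits (suc i) p (cong advance e) in j , ≤-trans (n≤1+n i) i<j , e′

  passes : ∀ i {x b c d} (p : Star _⊢_ b c) (s : c ⊢ d) (q : Star _⊢_ d (at (following x))) →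
    pointer i ≡ (x , b , join p s q) → ∃[ j ] i ≤ j × run j ≡ c
  passes i ε            s q e = i , ≤-refl , cong config e
  passes i (_ ◅ ε)      s q e = suc i , n≤1+n i , cong (config ∘ advance) e
  passes i (_ ◅ t ◅ ts) s q e =
    let j , i<j , e′ = passes (suc i) (t ◅ ts) s q (cong advance e) in
    j , ≤-trans (n≤1+n i) i<j , e′

  good-infinitely-often : ∀ i → ∃[ j ] i ≤ j × Good (run j)
  good-infinitely-often i =
    -- The good configuration of the current stretch may already have been passed, so the one of the
    -- following stretch is taken.
    let x , _ , _ , _ , p      = pointer i
        j , i≤j , e            = exits i p refl
        _ , p , good , _ , s , q = stretch (following x)
        k , j≤k , e′           = passes j p s q e
    in k , ≤-trans i≤j j≤k , subst Good (sym e′) good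

  stretch-start : ℕ → X
  stretch-start zero    = x₀
  stretch-start (suc m) = following (stretch-start m)

  enters : ∀ m → ∃[ i ] pointer i ≡ enter (stretch-start m)
  enters zero    = 0 , refl
  enters (suc m) = let i , e = enters m ; j , _ , e′ = exits i _ e in j , e′

-- Tapes split at the head

infixr 5 _∙_ _▷_

_∙_ : {A : Set} → A → (ℕ → A) → ℕ → A
(x ∙ f) zero    = x
(x ∙ f) (suc i) = f i

_▷_ : {A : Set} → List A → (ℕ → A) → ℕ → A
[]       ▷ f = f
(x ∷ xs) ▷ f = x ∙ (xs ▷ f)

-- The reverse of the list followed by the stream: the list holds the cells left of the head,
-- nearest first.
rewind : {A : Set} → List A → (ℕ → A) → ℕ → A
rewind []      f = f
rewind (x ∷ L) f = rewind L (x ∙ f)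

-- Cell `j` of the stream ends up at `length L + j`, so at most one cell of it matters for a given
-- position.
rewind-local : ∀ {A : Set} (L : List A) {f g} i →
  (∀ j → length L + j ≡ i → f j ≡ g j) → rewind L f i ≡ rewind L g i
rewind-local []      i h = h i refl
rewind-local (x ∷ L) i h = rewind-local L i λ where
  zero    _ → refl
  (suc j) e → h j (trans (sym (+-suc (length L) j)) e)

rewind-cong : ∀ {A : Set} (L : List A) {f g} → f ≗ g → rewind L f ≗ rewind L g
rewind-cong L f≗g i = rewind-local L i (λ j _ → f≗g j)

rewind-at : ∀ {A : Set} (L : List A) f j → rewind L f (length L + j) ≡ f j
rewind-at []      f j = refl
rewind-at (x ∷ L) f j =
  trans (cong (rewind L (x ∙ f)) (sym (+-suc (length L) j))) (rewind-at L (x ∙ f) (suc j))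

rewind-head : ∀ {A : Set} (L : List A) f → rewind L f (length L) ≡ f 0
rewind-head L f = trans (cong (rewind L f) (sym (+-identityʳ (length L)))) (rewind-at L f 0)

rewind-tail : ∀ {A : Set} (L : List A) {f} {x y} i → i ≢ length L →
  rewind L (x ∙ f) i ≡ rewind L (y ∙ f) i
rewind-tail L i i≢ = rewind-local L i λ where
  zero    e → contradiction (trans (sym e) (+-identityʳ (length L))) i≢
  (suc _) _ → refl

module Zippers {n : ℕ} (M : Machine n) where
  open Machine M
  open Computation M
  open Config

  -- The head scans the first symbol of after.  The tape continues with a stream
  -- rest that is given separately: blanks or the unread input.

  record Zipper : Set where
    constructor zip
    field
      control      : Fin states
      before after : List Symbol

  infix 4 _⇒_ _⇒*_

  -- Steps depend on the read part of the tape alone, hence hold for every continuation. With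
  -- `after` empty there is no step until more of the tape is uncovered.
  data _⇒_ : Zipper → Zipper → Set where
    right : ∀ {p x q y L R} → (p , x , q , y , right) ∈ transitions →
            zip p L (x ∷ R) ⇒ zip q (y ∷ L) R
    left  : ∀ {p x q y l L R} → (p , x , q , y , left) ∈ transitions →
            zip p (l ∷ L) (x ∷ R) ⇒ zip q L (l ∷ y ∷ R)

  _⇒*_ : Zipper → Zipper → Set
  _⇒*_ = Star _⇒_

  infix 4 _∼_/_

  record _∼_/_ (c : Config) (z : Zipper) (rest : ℕ → Symbol) : Set where
    constructor rep
    open Zipper z
    field
      control≡  : state c ≡ control
      position≡ : position c ≡ length before
      tape≗     : tape c ≗ rewind before (after ▷ rest)

  canonical : Zipper → (ℕ → Symbol) → Config
  canonical (zip q L R) rest = ⟨ q , length L , rewind L (R ▷ rest) ⟩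

  canonical-∼ : ∀ {z rest} → canonical z rest ∼ z / rest
  canonical-∼ = rep refl refl (λ _ → refl)

  ∼-rest : ∀ {c q L R R′ rest rest′} → R ▷ rest ≗ R′ ▷ rest′ →
    c ∼ zip q L R / rest → c ∼ zip q L R′ / rest′
  ∼-rest {L = L} e (rep q p t) = rep q p (λ i → trans (t i) (rewind-cong L e i))

  module _ {c p L x R rest} (r : c ∼ zip p L (x ∷ R) / rest) where
    open _∼_/_ r

    scanned : tape c (position c) ≡ x
    scanned = trans (tape≗ _) (trans (cong (rewind L _) position≡) (rewind-head L _))

    written : ∀ y → rewind L (y ∙ R ▷ rest) (position c) ≡ y
    written y = trans (cong (rewind L _) position≡) (rewind-head L _)

    elsewhere : ∀ y i → i ≢ position c → tape c i ≡ rewind L (y ∙ R ▷ rest) i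
    elsewhere y i i≢ = trans (tape≗ i) (rewind-tail L i (subst (i ≢_) position≡ i≢))

    transition∈ : ∀ {q y m} → (p , x , q , y , m) ∈ transitions →
      (state c , tape c (position c) , q , rewind L (y ∙ R ▷ rest) (position c) , m) ∈ transitions
    transition∈ {q} {y} {m} t∈ rewrite control≡ | scanned | written y = t∈

  -- Allowing any `c` that represents the zipper lets the boundary between `after` and the rest of
  -- the tape be moved just before the step.
  simulate : ∀ {z z′ c rest} → c ∼ z / rest → z ⇒ z′ → c ⊢ canonical z′ rest
  simulate {zip p L (x ∷ R)} r@(rep _ p≡ _) (right {y = y} t∈) = record
    { transition = transition∈ r t∈
    ; moves      = subst (λ i → Moves right i (suc (length L))) (sym p≡) right
    ; unchanged  = λ i i≢ → sym (elsewhere r y i i≢)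
    }
  simulate {zip p (l ∷ L) (x ∷ R)} r@(rep _ p≡ _) (left {y = y} t∈) = record
    { transition = transition∈ r t∈
    ; moves      = subst (λ i → Moves left i (length L)) (sym p≡) left
    ; unchanged  = λ i i≢ → sym (elsewhere r y i i≢)
    }

  simulates : ∀ {z z′ rest} → z ⇒* z′ → Star _⊢_ (canonical z rest) (canonical z′ rest)
  simulates ε        = ε
  simulates (s ◅ ss) = simulate canonical-∼ s ◅ simulates ss

  -- The converse of `simulate`: while the head is on the read part, each machine step is a zipper
  -- step.
  follow : ∀ {c c′ p L x R rest} → c ∼ zip p L (x ∷ R) / rest → c ⊢ c′ →
    ∃[ z ] zip p L (x ∷ R) ⇒ z × c′ ∼ z / rest
  follow {c} {c′} {p} {L} {x} {R} {rest} r@(rep q≡ p≡ _) st = go moves transition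
    where
    open _⊢_ st
    y = tape c′ (position c)

    tape′ : tape c′ ≗ rewind L (y ∙ R ▷ rest)
    tape′ i with i ≟ position c
    ... | yes refl = sym (written r y)
    ... | no  i≢   = trans (unchanged i i≢) (elsewhere r y i i≢)

    go : ∀ {m} → Moves m (position c) (position c′) →
      (state c , tape c (position c) , state c′ , y , m) ∈ transitions →
      ∃[ z ] zip p L (x ∷ R) ⇒ z × c′ ∼ z / rest
    go mv t∈ rewrite q≡ | scanned r = turn mv p≡ t∈ tape′
      where
      turn : ∀ {L m i j} → Moves m i j → i ≡ length L → (p , x , state c′ , y , m) ∈ transitions →
        tape c′ ≗ rewind L (y ∙ R ▷ rest) →
        ∃[ z ] zip p L (x ∷ R) ⇒ z × ⟨ state c′ , j , tape c′ ⟩ ∼ z / rest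
      turn {_}     right e t∈ t = _ , right t∈ , rep refl (cong suc e) t
      turn {_ ∷ _} left  e t∈ t = _ , left t∈ , rep refl (suc-injective e) t

  blanks : ℕ → Symbol
  blanks _ = inj₂ zero

  -- Acceptance on finite data only: `pad` uncovers a blank when the head reaches the end of the
  -- read part.
  data Accepting : Zipper → Set where
    halt : ∀ {q L R} → q ∈ˢ final → Accepting (zip q L R)
    move : ∀ {z z′} → z ⇒ z′ → Accepting z′ → Accepting z
    pad  : ∀ {q L} → Accepting (zip q L (inj₂ zero ∷ [])) → Accepting (zip q L [])

  pad-blanks : ∀ {A : Set} {x : A} i → ([] ▷ λ _ → x) i ≡ ((x ∷ []) ▷ λ _ → x) i
  pad-blanks zero    = refl
  pad-blanks (suc i) = refl

  accepting-run : ∀ {z c} → Accepting z → c ∼ z / blanks → ∃[ c′ ] Star _⊢_ c c′ × state c′ ∈ˢ final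
  accepting-run (halt q∈) (rep refl _ _) = _ , ε , q∈
  accepting-run (move s a) r =
    let c , run , f = accepting-run a canonical-∼ in c , simulate r s ◅ run , f
  accepting-run (pad a) r = accepting-run a (∼-rest pad-blanks r)

  run-accepting : ∀ {z c c′} → Star _⊢_ c c′ → state c′ ∈ˢ final → c ∼ z / blanks → Accepting z
  run-accepting ε f (rep refl _ _) = halt f
  run-accepting {zip q L []} (st ◅ run) f r =
    let _ , s , r′ = follow (∼-rest pad-blanks r) st in pad (move s (run-accepting run f r′))
  run-accepting {zip q L (x ∷ R)} (st ◅ run) f r =
    let _ , s , r′ = follow r st in move s (run-accepting run f r′)

  padded-▷ : ∀ v → padded v ≗ map inj₁ v ▷ blanks
  padded-▷ []      i       = refl
  padded-▷ (a ∷ v) zero    = refl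
  padded-▷ (a ∷ v) (suc i) = padded-▷ v i

  accepts⇔ : ∀ v → Accepts v ⇔ Accepting (zip start [] (map inj₁ v))
  accepts⇔ v = mk⇔
    (λ { (c , c′ , (q , p , t) , run , f) →
         run-accepting run f (rep q p (λ i → trans (t i) (padded-▷ v i))) })
    (λ a → let c , run , f = accepting-run a (rep refl refl (padded-▷ v)) in
         ⟨ start , 0 , padded v ⟩ , c , (refl , refl , λ _ → refl) , run , f)

  -- The head is still on the segment, so a step follows the visit, and the configuration shared by
  -- two consecutive segments is not counted for the earlier one.
  data Visiting : Zipper → Set where
    visit : ∀ {q L x R} → q ∈ˢ final → Visiting (zip q L (x ∷ R))

  -- Runs that leave the zipper to the right, in state q with the symbols L
  -- behind the head, after visiting a final state.

  Crossing : Zipper → Fin states → List Symbol → Set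
  Crossing z q L = ∃[ f ] z ⇒* f × Visiting f × f ⇒* zip q L []

  size : Zipper → ℕ
  size (zip _ L R) = length L + length R

  size-⇒ : ∀ {z z′} → z ⇒ z′ → size z ≡ size z′
  size-⇒ (right {L = L} {R} _) = +-suc (length L) (length R)
  size-⇒ (left {L = L} {R} _)  = sym (+-suc (length L) (suc (length R)))

  size-⇒* : ∀ {z z′} → z ⇒* z′ → size z ≡ size z′
  size-⇒* ε        = refl
  size-⇒* (s ◅ ss) = trans (size-⇒ s) (size-⇒* ss)

  -- The number of cells is invariant. In the end all of them lie behind the head, whereas at the
  -- start at least one lies ahead, as a visit or a step requires.
  crossing-grows : ∀ {p L R q L′} → Crossing (zip p L R) q L′ → length L < length L′
  crossing-grows (_ , ε , visit {L = L} _ , ss) = subst (length L <_)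
    (trans (size-⇒* ss) (+-identityʳ _)) (m<m+n (length L) (s≤s z≤n))
  crossing-grows {L = L} {_ ∷ R} (_ , ss@(_ ◅ _) , _ , ss′) = subst (length L <_)
    (trans (size-⇒* (ss ◅◅ ss′)) (+-identityʳ _)) (m<m+n (length L) (s≤s z≤n))

  position-step : ∀ {c d} → c ⊢ d → position d ≤ suc (position c)
  position-step st with _⊢_.moves st
  ... | moves = go moves
    where
    go : ∀ {m i j} → Moves m i j → j ≤ suc i
    go left  = ≤-trans (n≤1+n _) (n≤1+n _)
    go right = ≤-refl

  -- Büchi runs and sequences of batches

  module Infinite (v : ℕ → Fin n) where

    from : ℕ → ℕ → Symbol
    from i zero    = inj₁ (v i)
    from i (suc j) = from (suc i) j

    from-+ : ∀ i j → from i j ≡ inj₁ (v (i + j))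
    from-+ i zero    = cong (inj₁ ∘ v) (sym (+-identityʳ i))
    from-+ i (suc j) = trans (from-+ (suc i) j) (cong (inj₁ ∘ v) (sym (+-suc i j)))

    data Segment : ℕ → List Symbol → ℕ → Set where
      []  : ∀ {i} → Segment i [] i
      _∷_ : ∀ i {u j} → Segment (suc i) u j → Segment i (inj₁ (v i) ∷ u) j

    segment-▷ : ∀ {i u j} → Segment i u j → u ▷ from j ≗ from i
    segment-▷ []      k       = refl
    segment-▷ (i ∷ s) zero    = refl
    segment-▷ (i ∷ s) (suc k) = segment-▷ s k

    -- Reading further input only moves the boundary between the finite part and the unread stream.
    load : ∀ {i u j c q L} → Segment i u j → c ∼ zip q L [] / from i → c ∼ zip q L u / from j
    load {i} s = ∼-rest {R = []} {rest = from i} (λ k → sym (segment-▷ s k))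

    record Frontier : Set where
      constructor frontier
      field
        offset : ℕ
        state  : Fin states
        behind : List Symbol

    Batch : Frontier → Frontier → List Symbol → Set
    Batch (frontier i q L) (frontier j q′ L′) u = Segment i u j × Crossing (zip q L u) q′ L′

    -- `P` is any invariant that always provides a next batch. Iterating from the initial frontier
    -- then yields an accepting run.
    module _ (P : Frontier → Set) (p₀ : P (frontier 0 start []))
      (advance : ∀ {f} → P f → ∃[ f′ ] P f′ × ∃[ u ] Batch f f′ u) where

      at : ∃[ f ] P f → Config
      at (frontier i q L , _) = canonical (zip q L []) (from i)

      following : ∃[ f ] P f → ∃[ f ] P f
      following (_ , p) = let f , p′ , _ = advance p in f , p′

      stretch : ∀ x → ∃[ c ] Star _⊢_ (at x) c × (state c ∈ˢ final) ×
                      ∃[ d ] c ⊢ d × Star _⊢_ d (at (following x))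
      stretch (f , p) with advance p
      -- The first step starts from the tape before loading, which agrees with the loaded one
      -- pointwise; the cases differ in whether this step precedes or follows the visit.
      ... | f′ , p′ , u , s , _ , ε , visit q∈ , t ◅ ts =
        _ , ε , q∈ , _ , simulate (load s canonical-∼) t , simulates ts
      ... | f′ , p′ , u , s , _ , t ◅ ts , visit q∈ , t′ ◅ ts′ =
        _ , simulate (load s canonical-∼) t ◅ simulates ts , q∈ ,
        _ , simulate canonical-∼ t′ , simulates ts′

      open Chain following at stretch (_ , p₀) hiding (advance)

      position-grows : ∀ x → position (at x) < position (at (following x))
      position-grows (f , p) = let _ , _ , _ , _ , c = advance p in crossing-grows c

      position-unbounded : ∀ m → m ≤ position (at (stretch-start m))
      position-unbounded zero    = z≤n
      position-unbounded (suc m) =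
        ≤-<-trans (position-unbounded m) (position-grows (stretch-start m))

      -- Discrete intermediate values: the head starts at cell zero and advances by at most one cell
      -- per step.
      intermediate : ∀ p i → p ≤ position (run i) → ∃[ j ] position (run j) ≡ p
      intermediate p i p≤ with position (run i) ≟ p
      ... | yes e = i , e
      intermediate zero zero    p≤ | no ≢p = contradiction refl ≢p
      intermediate p    (suc i) p≤ | no ≢p = intermediate p i
        (≤-pred (≤-trans (≤∧≢⇒< p≤ (≢p ∘ sym)) (position-step (run-step i))))

      batches-accepted : Acceptsω v
      batches-accepted =
        run ,
        (refl , refl , λ j → from-+ 0 j) ,
        run-step ,
        (λ p → let i , e = enters p in intermediate p i
          (subst (λ x → p ≤ position (config x)) (sym e) (position-unbounded p))) ,
        good-infinitely-often

    -- Cutting an accepting run into batches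

    segment : ∀ {i j} → i ≤‴ j → ∃[ u ] Segment i u j × length u + i ≡ j
    segment ≤‴-refl         = [] , [] , refl
    segment {i} (≤‴-step l) =
      let u , s , e = segment l in _ , i ∷ s , trans (sym (+-suc (length u) i)) e

    module _ (accepted : Acceptsω v) where

      private
        r : ℕ → Config
        r = proj₁ accepted

        initial : Initial (inj₁ ∘ v) (r 0)
        initial = proj₁ (proj₂ accepted)

        steps : ∀ k → r k ⊢ r (suc k)
        steps = proj₁ (proj₂ (proj₂ accepted))

        complete : ∀ p → ∃[ k ] position (r k) ≡ p
        complete = proj₁ (proj₂ (proj₂ (proj₂ accepted)))

        büchi : ∀ k → ∃[ m ] k ≤ m × state (r m) ∈ˢ final
        büchi = proj₂ (proj₂ (proj₂ (proj₂ accepted)))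

      position-≤ : ∀ k → position (r k) ≤ k
      position-≤ zero    = ≤-reflexive (proj₁ (proj₂ initial))
      position-≤ (suc k) = ≤-trans (position-step (steps k)) (s≤s (position-≤ k))

      record Reached (f : Frontier) : Set where
        constructor reached
        open Frontier f renaming (state to q)
        field
          time    : ℕ
          behind≡ : length behind ≡ offset
          reaches : r time ∼ zip q behind [] / from offset

      first : Reached (frontier 0 start [])
      first = reached 0 refl (rep (proj₁ initial) (proj₁ (proj₂ initial))
        λ i → trans (proj₂ (proj₂ initial) i) (sym (from-+ 0 i)))

      -- At time `m` the head is on cell `e`, just beyond the `e` cells of the zipper, so it leaves
      -- the zipper no later than that.
      leave : ∀ {k m e z} → k ≤‴ m → position (r m) ≡ e → r k ∼ z / from e → size z ≡ e →
        ∃[ q ] ∃[ L ] Reached (frontier e q L) × z ⇒* zip q L []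
      leave {z = zip q L []} k≤m p≡ c size≡ =
        q , L , reached _ (trans (sym (+-identityʳ _)) size≡) c , ε
      leave {z = zip q L (x ∷ R)} ≤‴-refl p≡ c size≡ =
        contradiction (trans (sym (_∼_/_.position≡ c)) (trans p≡ (sym size≡)))
          (<⇒≢ (m<m+n (length L) (s≤s z≤n)))
      leave {z = zip q L (x ∷ R)} (≤‴-step l) p≡ c size≡ =
        let _ , s , c′      = follow c (steps _)
            q′ , L′ , f , ss = leave l p≡ c′ (trans (sym (size-⇒ s)) size≡)
        in q′ , L′ , f , s ◅ ss

      -- By time `m` the head has reached cell `m` at most, so with `m < e` the final state is
      -- visited before the head leaves the `e` cells.
      cross : ∀ {k m t e z} → k ≤‴ m → m < e → state (r m) ∈ˢ final → e ≤ t → position (r t) ≡ e →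
        r k ∼ z / from e → size z ≡ e → ∃[ q ] ∃[ L ] Reached (frontier e q L) × Crossing z q L
      cross {k} {z = zip q L []} k≤m m<e _ _ _ c size≡ =
        contradiction (subst (_≤ k) (trans (sym (+-identityʳ _)) size≡)
            (subst (_≤ k) (_∼_/_.position≡ c) (position-≤ k)))
          (<⇒≱ (≤-<-trans (≤‴⇒≤ k≤m) m<e))
      cross {m = m} {z = zip q L (x ∷ R)} ≤‴-refl m<e q∈ e≤t p≡ c@(rep refl _ _) size≡ =
        let q′ , L′ , f , ss = leave (≤⇒≤‴ (<⇒≤ (<-≤-trans m<e e≤t))) p≡ c size≡
        in q′ , L′ , f , _ , ε , visit q∈ , ss
      cross {z = zip q L (x ∷ R)} (≤‴-step l) m<e q∈ e≤t p≡ c size≡ =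
        let _ , s , c′                = follow c (steps _)
            q′ , L′ , f , g , ss , a , ts = cross l m<e q∈ e≤t p≡ c′ (trans (sym (size-⇒ s)) size≡)
        in q′ , L′ , f , g , s ◅ ss , a , ts

      -- The letter `v i` is split off because the automaton emits it in the very transition that
      -- guesses the batch.
      next-batch : ∀ {i q L} → Reached (frontier i q L) →
        ∃[ j ] ∃[ q′ ] ∃[ L′ ] Reached (frontier j q′ L′) ×
        ∃[ u ] Segment (suc i) u j × Crossing (zip q L (inj₁ (v i) ∷ u)) q′ L′
      next-batch {i} {q} {L} (reached k refl c) =
        -- The batch ends at cell `suc m`, where `m` is the time of a final state: this cell is out
        -- of reach up to time `m`, and completeness gives a later time `t` at which it is visited.
        let m , k≤m , q∈ = büchi k
            t , p≡       = complete (suc m)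
            i≤m          = ≤-trans (subst (_≤ k) (_∼_/_.position≡ c) (position-≤ k)) k≤m
            u , s , e    = segment (≤⇒≤‴ (s≤s i≤m))
            q′ , L′ , f , cr = cross (≤⇒≤‴ k≤m) ≤-refl q∈ (subst (_≤ t) p≡ (position-≤ t)) p≡
              (load (i ∷ s) c)
              (trans (+-comm i (suc (length u))) (trans (sym (+-suc (length u) i)) e))
        in suc m , q′ , L′ , f , u , s , cr

-- The Horn program of two machines

⌜_⌝ : ∀ {m} → Fin m → Tree
⌜ zero ⌝  = nil
⌜ suc i ⌝ = nil · ⌜ i ⌝

⌜_⌝ˢ : ∀ {m w} → Fin m ⊎ Fin w → Tree
⌜ inj₁ a ⌝ˢ = nil · ⌜ a ⌝
⌜ inj₂ b ⌝ˢ = (nil · nil) · ⌜ b ⌝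

⌜_⌝ˡ : ∀ {m w} → List (Fin m ⊎ Fin w) → Tree
⌜ [] ⌝ˡ    = nil
⌜ x ∷ u ⌝ˡ = ⌜ x ⌝ˢ · ⌜ u ⌝ˡ

·-injective : ∀ {s t u v : Tree} → s · t ≡ u · v → s ≡ u × t ≡ v
·-injective refl = refl , refl

⌜⌝-injective : ∀ {m} {i j : Fin m} → ⌜ i ⌝ ≡ ⌜ j ⌝ → i ≡ j
⌜⌝-injective {i = zero}  {zero}  _ = refl
⌜⌝-injective {i = suc i} {suc j} e = cong suc (⌜⌝-injective (proj₂ (·-injective e)))

⌜⌝ˢ-injective : ∀ {m w} {x y : Fin m ⊎ Fin w} → ⌜ x ⌝ˢ ≡ ⌜ y ⌝ˢ → x ≡ y
⌜⌝ˢ-injective {x = inj₁ a} {inj₁ b} e = cong inj₁ (⌜⌝-injective (proj₂ (·-injective e)))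
⌜⌝ˢ-injective {x = inj₂ a} {inj₂ b} e = cong inj₂ (⌜⌝-injective (proj₂ (·-injective e)))

visited : Tree
visited = nil · nil

-- The machine reaches g from the zipper (q , L , R); here g is nil for acceptance
-- of a finite word, and a Goal (below) for the ω-acceptor.

simᵖ : ∀ {n} → Pattern n → Pattern n → Pattern n → Pattern n → Pattern n
simᵖ g q L R = con ((nil · nil) · nil) · g · q · L · R

sim : Tree → Tree → Tree → Tree → Tree
sim g q L R = ((nil · nil) · nil) · g · q · L · R

pattern v₀ = var zero
pattern v₁ = var (suc zero)
pattern v₂ = var (suc (suc zero))
pattern v₃ = var (suc (suc (suc zero)))
pattern v₄ = var (suc (suc (suc (suc zero))))
pattern v₅ = var (suc (suc (suc (suc (suc zero)))))

module _ {n : ℕ} (M : Machine n) where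
  open Machine M
  open Zippers M

  -- `v₀` and `v₁` stand for the rest of the tape on either side, `v₂` for the cell left of the
  -- head; `v₃` and `v₄` are reserved for the goal.
  moveClause : Pattern 5 → Fin states × Symbol × Fin states × Symbol × Move → Clause
  moveClause g (p , x , q , y , right) =
    simᵖ g (con ⌜ p ⌝) v₀ (con ⌜ x ⌝ˢ · v₁) ⇐ (simᵖ g (con ⌜ q ⌝) (con ⌜ y ⌝ˢ · v₀) v₁ ∷ [])
  moveClause g (p , x , q , y , left) =
    simᵖ g (con ⌜ p ⌝) (v₂ · v₀) (con ⌜ x ⌝ˢ · v₁) ⇐
      (simᵖ g (con ⌜ q ⌝) v₀ (v₂ · con ⌜ y ⌝ˢ · v₁) ∷ [])

  finals : List (Fin states)
  finals = filter (_∈? final) (allFin states)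

  -- Quantifying over all zippers with these codes makes the claim vacuous on trees that code none,
  -- so clauses may be applied to arbitrary trees.
  Coded : (Zipper → Set) → Tree → Tree → Tree → Set
  Coded P q L R = ∀ z → let open Zipper z in
    q ≡ ⌜ control ⌝ → L ≡ ⌜ before ⌝ˡ → R ≡ ⌜ after ⌝ˡ → P z

  module _ {P : Zipper → Set} (P-move : ∀ {z z′} → z ⇒ z′ → P z′ → P z) where

    -- By injectivity of the codes, any zipper coded by the head of the clause is one to which the
    -- transition applies.
    coded-right : ∀ {p x q y L R} → (p , x , q , y , right) ∈ transitions →
      Coded P ⌜ q ⌝ (⌜ y ⌝ˢ · L) R → Coded P ⌜ p ⌝ L (⌜ x ⌝ˢ · R)
    coded-right t∈ c (zip p L (x ∷ R)) p≡ refl R≡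
      with ⌜⌝-injective p≡ | ·-injective R≡
    ... | refl | x≡ , refl with ⌜⌝ˢ-injective x≡
    ...   | refl = P-move (right t∈) (c _ refl refl refl)

    coded-left : ∀ {p x q y l L R} → (p , x , q , y , left) ∈ transitions →
      Coded P ⌜ q ⌝ L (l · ⌜ y ⌝ˢ · R) → Coded P ⌜ p ⌝ (l · L) (⌜ x ⌝ˢ · R)
    coded-left t∈ c (zip p (l ∷ L) (x ∷ R)) p≡ refl R≡
      with ⌜⌝-injective p≡ | ·-injective R≡
    ... | refl | x≡ , refl with ⌜⌝ˢ-injective x≡
    ...   | refl = P-move (left t∈) (c _ refl refl refl)

  -- In the goal b · g, the tree g codes the state and the tape at the time the
  -- head leaves the tape to the right; a final state is to be visited before,
  -- unless b is visited.

  data Goal : Tree → Tree → Zipper → Set where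
    arrive : ∀ {q L} → Goal visited (⌜ q ⌝ · ⌜ L ⌝ˡ) (zip q L [])
    move   : ∀ {b g z z′} → z ⇒ z′ → Goal b g z′ → Goal b g z
    visit  : ∀ {g q L x R} → q ∈ˢ final → Goal visited g (zip q L (x ∷ R)) →
             Goal nil g (zip q L (x ∷ R))

  done-goal : ∀ {g z} → Goal visited g z → ∃[ q ] ∃[ L ] g ≡ ⌜ q ⌝ · ⌜ L ⌝ˡ × z ⇒* zip q L []
  done-goal arrive     = _ , _ , refl , ε
  done-goal (move s G) = let q , L , e , ss = done-goal G in q , L , e , s ◅ ss

  crossing-goal : ∀ {g z} → Goal nil g z → ∃[ q ] ∃[ L ] g ≡ ⌜ q ⌝ · ⌜ L ⌝ˡ × Crossing z q L
  crossing-goal (move s G) =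
    let q , L , e , f , ss , v , ts = crossing-goal G in q , L , e , f , s ◅ ss , v , ts
  crossing-goal (visit q∈ G) =
    let q , L , e , ss = done-goal G in q , L , e , _ , ε , visit q∈ , ss

  goal-done : ∀ {z q L} → z ⇒* zip q L [] → Goal visited (⌜ q ⌝ · ⌜ L ⌝ˡ) z
  goal-done ε        = arrive
  goal-done (s ◅ ss) = move s (goal-done ss)

  goal-crossing : ∀ {z q L} → Crossing z q L → Goal nil (⌜ q ⌝ · ⌜ L ⌝ˡ) z
  goal-crossing (_ , ε , visit q∈ , ts)  = visit q∈ (goal-done ts)
  goal-crossing (f , s ◅ ss , v , ts)   = move s (goal-crossing (f , ss , v , ts))

-- The program, its clauses and a model of it

module Program {n : ℕ} (F Ω : Machine n) where
  private
    module F = Machine F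
    module Ω = Machine Ω
    module FZ = Zippers F
    module ΩZ = Zippers Ω
  open FZ using (Accepting; halt; move; pad)
  open Computation using (Accepts; Acceptsω)

  -- The code of the tape symbol `inj₁ a`, so that a list of labels is at the same time the code of
  -- a piece of input.
  label : Fin n → Tree
  label a = nil · ⌜ a ⌝

  haltClause : Fin F.states → Clause
  haltClause q = _⇐_ {2} (simᵖ (con nil) (con ⌜ q ⌝) v₀ v₁) []

  visitClause : Fin Ω.states → Clause
  visitClause q = _⇐_ {4} (simᵖ (con nil · v₀) (con ⌜ q ⌝) v₁ (v₂ · v₃))
    (simᵖ (con visited · v₀) (con ⌜ q ⌝) v₁ (v₂ · v₃) ∷ [])

  -- States of the automaton: nil initially; otherwise u · g, where u codes the
  -- letters still to be emitted, and then the word ends if g is nil, and if g is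
  -- q · L, the ω-acceptor resumes in state q at the first unread cell with the
  -- symbols L behind its head.

  controlClauses haltClauses visitClauses moveClausesF moveClausesΩ program : List Clause
  controlClauses =
    _⇐_ {3} (nextᵖ v₀ ((v₀ · v₁) · v₂) (v₁ · v₂)) [] ∷
    _⇐_ {1} (endᵖ v₀ ((v₀ · con nil) · con nil)) [] ∷
    -- The guessed batch is `v₀` followed by `v₃`. Its first letter is emitted at once, and
    -- `v₄ · v₅` is the guessed outcome of the crossing.
    _⇐_ {6} (nextᵖ v₀ (con nil · v₁ · v₂) (v₃ · v₄ · v₅))
      (simᵖ (con nil · v₄ · v₅) v₁ v₂ (v₀ · v₃) ∷ []) ∷
    _⇐_ {4} (nextᵖ v₀ (con nil) (v₁ · v₂ · v₃))
      (simᵖ (con nil · v₂ · v₃) (con ⌜ Ω.start ⌝) (con nil) (v₀ · v₁) ∷ []) ∷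
    -- The whole finite word is guessed and checked at its first letter; the `nil` in the new state
    -- commits to ending after the word.
    _⇐_ {2} (nextᵖ v₀ (con nil) (v₁ · con nil))
      (simᵖ (con nil) (con ⌜ F.start ⌝) (con nil) (v₀ · v₁) ∷ []) ∷
    _⇐_ {1} (endᵖ v₀ (con nil))
      (simᵖ (con nil) (con ⌜ F.start ⌝) (con nil) (v₀ · con nil) ∷ []) ∷
    _⇐_ {2} (simᵖ (con nil) v₀ v₁ (con nil))
      (simᵖ (con nil) v₀ v₁ (con ⌜ F.Symbol ∋ inj₂ zero ⌝ˢ · con nil) ∷ []) ∷
    _⇐_ {2} (simᵖ (con visited · v₀ · v₁) v₀ v₁ (con nil)) [] ∷ []
  haltClauses = map haltClause (finals F)
  visitClauses = map visitClause (finals Ω)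
  moveClausesF = map (moveClause F (con nil)) F.transitions
  moveClausesΩ = map (moveClause Ω (v₃ · v₄)) Ω.transitions
  program = controlClauses ++ haltClauses ++ visitClauses ++ moveClausesF ++ moveClausesΩ

  Accepted : Tree → Tree → Tree → Set
  Accepted = Coded F Accepting

  Attained : Tree → Tree → Tree → Tree → Tree → Set
  Attained b g = Coded Ω (Goal Ω b g)

  data NextView (a : Tree) : Tree → Tree → Set where
    emit    : ∀ {u g} → NextView a ((a · u) · g) (u · g)
    batch   : ∀ {q L u q′ L′} → Attained nil (q′ · L′) q L (a · u) →
              NextView a (nil · q · L) (u · q′ · L′)
    start-ω : ∀ {u q L} → Attained nil (q · L) ⌜ Ω.start ⌝ nil (a · u) → NextView a nil (u · q · L)
    start   : ∀ {u} → Accepted ⌜ F.start ⌝ nil (a · u) → NextView a nil (u · nil)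

  data EndView (a : Tree) : Tree → Set where
    end   : EndView a ((a · nil) · nil)
    start : Accepted ⌜ F.start ⌝ nil (a · nil) → EndView a nil

  -- A model of the program, trivial on trees of no listed form. As derivability is the least
  -- relation closed under the clauses, inverting derivations reduces to checking each clause once.
  Meaning : Tree → Set
  Meaning (nil · a · s · t)                           = NextView a s t
  Meaning ((nil · nil) · a · s)                       = EndView a s
  Meaning (((nil · nil) · nil) · nil · q · L · R)     = Accepted q L R
  Meaning (((nil · nil) · nil) · (b · g) · q · L · R) = Attained b g q L R
  Meaning _                                           = ⊤

  Closed : Clause → Set
  Closed (head ⇐ premises) = ∀ σ → All (λ p → Meaning (p ⟨ σ ⟩)) premises → Meaning (head ⟨ σ ⟩)

  control-closed : All Closed controlClauses
  control-closed =
    (λ { (_ ∷ _ ∷ _ ∷ []) [] → emit }) ∷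
    (λ { (_ ∷ []) [] → end }) ∷
    (λ { (_ ∷ _ ∷ _ ∷ _ ∷ _ ∷ _ ∷ []) (m ∷ []) → batch m }) ∷
    (λ { (_ ∷ _ ∷ _ ∷ _ ∷ []) (m ∷ []) → start-ω m }) ∷
    (λ { (_ ∷ _ ∷ []) (m ∷ []) → start m }) ∷
    (λ { (_ ∷ []) (m ∷ []) → start m }) ∷
    (λ { (_ ∷ _ ∷ []) (m ∷ []) (FZ.zip q L []) refl refl refl → pad (m _ refl refl refl) }) ∷
    (λ { (_ ∷ _ ∷ []) [] (ΩZ.zip q L []) refl refl refl → arrive }) ∷ []

  halt-closed : ∀ {q} → q ∈ finals F → Closed (haltClause q)
  halt-closed q∈ (_ ∷ _ ∷ []) [] z q≡ _ _ = halt
    (subst (_∈ˢ F.final) (⌜⌝-injective q≡)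
      (proj₂ (∈-filter⁻ (_∈? F.final) {xs = allFin F.states} q∈)))

  visit-closed : ∀ {q} → q ∈ finals Ω → Closed (visitClause q)
  visit-closed q∈ (_ ∷ _ ∷ _ ∷ _ ∷ []) (m ∷ []) z@(ΩZ.zip _ _ (_ ∷ _)) q≡ L≡ R≡ = visit
    (subst (_∈ˢ Ω.final) (⌜⌝-injective q≡)
      (proj₂ (∈-filter⁻ (_∈? Ω.final) {xs = allFin Ω.states} q∈)))
    (m z q≡ L≡ R≡)

  moveF-closed : ∀ {t} → t ∈ F.transitions → Closed (moveClause F (con nil) t)
  moveF-closed {_ , _ , _ , _ , right} t∈ (_ ∷ _ ∷ _ ∷ _ ∷ _ ∷ []) (m ∷ []) =
    coded-right F move t∈ m
  moveF-closed {_ , _ , _ , _ , left}  t∈ (_ ∷ _ ∷ _ ∷ _ ∷ _ ∷ []) (m ∷ []) =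
    coded-left F move t∈ m

  moveΩ-closed : ∀ {t} → t ∈ Ω.transitions → Closed (moveClause Ω (v₃ · v₄) t)
  moveΩ-closed {_ , _ , _ , _ , right} t∈ (_ ∷ _ ∷ _ ∷ _ ∷ _ ∷ []) (m ∷ []) =
    coded-right Ω move t∈ m
  moveΩ-closed {_ , _ , _ , _ , left}  t∈ (_ ∷ _ ∷ _ ∷ _ ∷ _ ∷ []) (m ∷ []) =
    coded-left Ω move t∈ m

  program-closed : All Closed program
  program-closed = All.++⁺ control-closed
    (All.++⁺ (All.map⁺ {f = haltClause} (All.tabulate halt-closed))
    (All.++⁺ (All.map⁺ {f = visitClause} (All.tabulate visit-closed))
    (All.++⁺ (All.map⁺ {f = moveClause F (con nil)} (All.tabulate moveF-closed))
             (All.map⁺ {f = moveClause Ω (v₃ · v₄)} (All.tabulate moveΩ-closed)))))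

  mutual
    meaning : ∀ {t} → program ⊩ t → Meaning t
    meaning (by c∈ σ ds) = All.lookup program-closed c∈ σ (meanings σ ds)

    meanings : ∀ {m} σ {ps : List (Pattern m)} → All (λ p → program ⊩ p ⟨ σ ⟩) ps →
      All (λ p → Meaning (p ⟨ σ ⟩)) ps
    meanings σ []       = []
    meanings σ (d ∷ ds) = meaning d ∷ meanings σ ds

  ∈-halt : ∀ {c} → c ∈ haltClauses → c ∈ program
  ∈-halt = ∈-++⁺ʳ controlClauses ∘ ∈-++⁺ˡ {xs = haltClauses}

  ∈-visit : ∀ {c} → c ∈ visitClauses → c ∈ program
  ∈-visit = ∈-++⁺ʳ controlClauses ∘ ∈-++⁺ʳ haltClauses ∘ ∈-++⁺ˡ

  ∈-moveF : ∀ {c} → c ∈ moveClausesF → c ∈ program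
  ∈-moveF = ∈-++⁺ʳ controlClauses ∘ ∈-++⁺ʳ haltClauses ∘ ∈-++⁺ʳ visitClauses ∘ ∈-++⁺ˡ

  ∈-moveΩ : ∀ {c} → c ∈ moveClausesΩ → c ∈ program
  ∈-moveΩ = ∈-++⁺ʳ controlClauses ∘ ∈-++⁺ʳ haltClauses ∘ ∈-++⁺ʳ visitClauses ∘ ∈-++⁺ʳ moveClausesF

  derive-accepting : ∀ {q L R} → Accepting (FZ.zip q L R) →
    program ⊩ sim nil ⌜ q ⌝ ⌜ L ⌝ˡ ⌜ R ⌝ˡ
  derive-accepting {L = L} {R} (halt q∈) =
    by (∈-halt (∈-map⁺ _ (∈-filter⁺ (_∈? F.final) (∈-allFin _) q∈))) (⌜ L ⌝ˡ ∷ ⌜ R ⌝ˡ ∷ []) []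
  derive-accepting (move (FZ.right {L = L} {R} t∈) a) =
    -- `nil` is a placeholder at `v₂`, `v₃` and `v₄`.
    by (∈-moveF (∈-map⁺ _ t∈)) (⌜ L ⌝ˡ ∷ ⌜ R ⌝ˡ ∷ nil ∷ nil ∷ nil ∷ []) (derive-accepting a ∷ [])
  derive-accepting (move (FZ.left {l = l} {L} {R} t∈) a) =
    by (∈-moveF (∈-map⁺ _ t∈)) (⌜ L ⌝ˡ ∷ ⌜ R ⌝ˡ ∷ ⌜ l ⌝ˢ ∷ nil ∷ nil ∷ []) (derive-accepting a ∷ [])
  derive-accepting {q} {L} (pad a) =
    by (there (there (there (there (there (there (here refl)))))))
      (⌜ q ⌝ ∷ ⌜ L ⌝ˡ ∷ []) (derive-accepting a ∷ [])

  derive-goal : ∀ {b g q L R} → Goal Ω b g (ΩZ.zip q L R) →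
    program ⊩ sim (b · g) ⌜ q ⌝ ⌜ L ⌝ˡ ⌜ R ⌝ˡ
  derive-goal {q = q} {L} arrive =
    by (there (there (there (there (there (there (there (here refl))))))))
      (⌜ q ⌝ ∷ ⌜ L ⌝ˡ ∷ []) []
  derive-goal {b} {g} (move (ΩZ.right {L = L} {R} t∈) G) =
    by (∈-moveΩ (∈-map⁺ _ t∈)) (⌜ L ⌝ˡ ∷ ⌜ R ⌝ˡ ∷ nil ∷ b ∷ g ∷ []) (derive-goal G ∷ [])
  derive-goal {b} {g} (move (ΩZ.left {l = l} {L} {R} t∈) G) =
    by (∈-moveΩ (∈-map⁺ _ t∈)) (⌜ L ⌝ˡ ∷ ⌜ R ⌝ˡ ∷ ⌜ l ⌝ˢ ∷ b ∷ g ∷ []) (derive-goal G ∷ [])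
  derive-goal {g = g} {L = L} {x ∷ R} (visit q∈ G) =
    by (∈-visit (∈-map⁺ _ (∈-filter⁺ (_∈? Ω.final) (∈-allFin _) q∈)))
      (g ∷ ⌜ L ⌝ˡ ∷ ⌜ x ⌝ˢ ∷ ⌜ R ⌝ˡ ∷ []) (derive-goal G ∷ [])

  open Automaton program label

  next-emit : ∀ {a u g} → Next a ((label a · u) · g) (u · g)
  next-emit {a} {u} {g} = by (here refl) (label a ∷ u ∷ g ∷ []) []

  end-emit : ∀ {a} → End a ((label a · nil) · nil)
  end-emit {a} = by (there (here refl)) (label a ∷ []) []

  next-crossing : ∀ {a u q L q′ L′} → ΩZ.Crossing (ΩZ.zip q L (inj₁ a ∷ u)) q′ L′ →
    Next a (nil · ⌜ q ⌝ · ⌜ L ⌝ˡ) (⌜ u ⌝ˡ · ⌜ q′ ⌝ · ⌜ L′ ⌝ˡ)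
  next-crossing {a} {u} {q} {L} {q′} {L′} c =
    by (there (there (here refl)))
      (label a ∷ ⌜ q ⌝ ∷ ⌜ L ⌝ˡ ∷ ⌜ u ⌝ˡ ∷ ⌜ q′ ⌝ ∷ ⌜ L′ ⌝ˡ ∷ [])
      (derive-goal (goal-crossing Ω c) ∷ [])

  next-start-ω : ∀ {a u q L} → ΩZ.Crossing (ΩZ.zip Ω.start [] (inj₁ a ∷ u)) q L →
    Next a nil (⌜ u ⌝ˡ · ⌜ q ⌝ · ⌜ L ⌝ˡ)
  next-start-ω {a} {u} {q} {L} c =
    by (there (there (there (here refl))))
      (label a ∷ ⌜ u ⌝ˡ ∷ ⌜ q ⌝ ∷ ⌜ L ⌝ˡ ∷ [])
      (derive-goal (goal-crossing Ω c) ∷ [])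

  next-start : ∀ {a u} → Accepting (FZ.zip F.start [] (inj₁ a ∷ u)) → Next a nil (⌜ u ⌝ˡ · nil)
  next-start {a} {u} acc = by (there (there (there (there (here refl)))))
    (label a ∷ ⌜ u ⌝ˡ ∷ []) (derive-accepting acc ∷ [])

  end-start : ∀ {a} → Accepting (FZ.zip F.start [] (inj₁ a ∷ [])) → End a nil
  end-start {a} acc = by (there (there (there (there (there (here refl))))))
    (label a ∷ []) (derive-accepting acc ∷ [])

  -- Paths of the automaton and accepted words

  word : List (Fin n) → Tree
  word v = ⌜ map {B = F.Symbol} inj₁ v ⌝ˡ

  -- With second component `nil` only emission and ending are possible, so the path spells out
  -- exactly the guessed word.
  path-word : ∀ {v} u → Path (u · nil) v → u ≡ word v
  path-word u (done e) with meaning e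
  ... | end = refl
  path-word u (x ∷ p) with meaning x
  ... | emit = cong (_ ·_) (path-word _ p)

  -- Transitions keep the second component a pair, while ending from such a state would need it to
  -- be `nil`.
  no-path : ∀ {u q L v} → ¬ Path (u · q · L) v
  no-path (done e) with () ← meaning e
  no-path (x ∷ p) with meaning x
  ... | emit    = no-path p
  ... | batch _ = no-path p

  word-path : ∀ a v → Path (word (a ∷ v) · nil) (a ∷ v)
  word-path a []      = done end-emit
  word-path a (b ∷ v) = next-emit ∷ word-path b v

  -- Nonemptiness is stated separately because the acceptor may accept the empty word, which no path
  -- spells.
  paths⇔ : ∀ {v} → Path nil v ⇔ (v ≢ [] × Accepts F v)
  paths⇔ {v} = mk⇔ to (λ (≢[] , a) → from v ≢[] (Equivalence.to (FZ.accepts⇔ v) a))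
    where
    to : ∀ {v} → Path nil v → v ≢ [] × Accepts F v
    to {v} p = (λ { refl → nonempty p }) , Equivalence.from (FZ.accepts⇔ v) (accepting p)
      where
      nonempty : ∀ {s} → ¬ Path s []
      nonempty ()
      accepting : ∀ {v} → Path nil v → Accepting (FZ.zip F.start [] (map inj₁ v))
      accepting (done e) with meaning e
      ... | start m = m _ refl refl refl
      accepting (x ∷ p) with meaning x
      ... | start-ω _ = contradiction p no-path
      ... | start m with path-word _ p
      ...   | refl = m _ refl refl refl
    from : ∀ v → v ≢ [] → Accepting (FZ.zip F.start [] (map inj₁ v)) → Path nil v
    from []          ≢[] _   = contradiction refl ≢[]
    from (a ∷ [])    _   acc = done (end-start acc)
    from (a ∷ b ∷ v) _   acc = next-start acc ∷ word-path b v

  emit-view : ∀ {a s t g r} → NextView a ((s · t) · g) r → s ≡ a × r ≡ t · g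
  emit-view emit = refl , refl

  batch-view : ∀ {a q L r} → NextView a (nil · q · L) r →
    ∃[ u ] ∃[ q′ ] ∃[ L′ ] r ≡ u · q′ · L′ × Attained nil (q′ · L′) q L (a · u)
  batch-view (batch m) = _ , _ , _ , refl , m

  module _ {v : ℕ → Fin n} {r : ℕ → Tree} (steps : ∀ i → Next (v i) (r i) (r (suc i))) where
    open ΩZ.Infinite v

    view : ∀ {s} i → r i ≡ s → NextView (label (v i)) s (r (suc i))
    view i refl = meaning (steps i)

    -- The guessed word shrinks with every transition, so a path that chose a finite word cannot be
    -- infinite.
    no-pathω : ∀ u i → ¬ r i ≡ u · nil
    no-pathω nil     i e with () ← view i e
    no-pathω (_ · u) i e = no-pathω u (suc i) (proj₂ (emit-view (view i e)))

    -- Until `u` is exhausted emission is the only transition. This decodes the guessed tree `u` as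
    -- the upcoming piece of the input.
    drain : ∀ {g} u i → r i ≡ u · g → ∃[ j ] ∃[ w ] Segment i w j × u ≡ ⌜ w ⌝ˡ × r j ≡ nil · g
    drain nil     i e = i , [] , [] , refl , e
    drain (s · u) i e with emit-view (view i e)
    ... | refl , e′ with drain u (suc i) e′
    ...   | j , w , seg , refl , e″ = j , _ , i ∷ seg , refl , e″

    -- The invariant for `batches-accepted`: transition `i` guesses a batch beginning with `v i`,
    -- whose remainder and outcome are still undecoded trees.
    Between : Frontier → Set
    Between (frontier i q L) = ∃[ u ] ∃[ q′ ] ∃[ L′ ]
      r (suc i) ≡ u · q′ · L′ × Attained nil (q′ · L′) ⌜ q ⌝ ⌜ L ⌝ˡ (label (v i) · u)

    between-start : r 0 ≡ nil → Between (frontier 0 Ω.start [])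
    between-start e with r 1 in e′ | view 0 e
    ... | _ | start-ω m = _ , _ , _ , refl , m
    ... | _ | start _   = contradiction e′ (no-pathω _ 1)

    between-advance : ∀ {f} → Between f → ∃[ f′ ] Between f′ × ∃[ u ] Batch f f′ u
    between-advance {frontier i q L} (u , q′ , L′ , e , m) with drain u (suc i) e
    ... | j , w , seg , refl , e′
      -- The drained segment supplies the zipper to which the coded claim is applied; the crossing
      -- then decodes the outcome.
      with crossing-goal Ω (m (ΩZ.zip q L (inj₁ (v i) ∷ w)) refl refl refl)
    ...   | q″ , L″ , refl , c =
      frontier j q″ L″ , batch-view (view j e′) , _ , i ∷ seg , c

  module _ {v : ℕ → Fin n} (accepted : Acceptsω Ω v) where
    open ΩZ.Infinite v

    -- A point inside a batch: `u` is still to be emitted, and the run reaches the frontier at the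
    -- end of the batch.
    Pending : ℕ → Set
    Pending i = ∃[ u ] ∃[ j ] ∃[ q ] ∃[ L ] Segment i u j × Reached accepted (frontier j q L)

    tree-of : ∀ {i} → Pending i → Tree
    tree-of (u , _ , q , L , _) = ⌜ u ⌝ˡ · ⌜ q ⌝ · ⌜ L ⌝ˡ

    continue : ∀ {i} (p : Pending i) → Σ[ p′ ∈ Pending (suc i) ] Next (v i) (tree-of p) (tree-of p′)
    continue (_ , j , q , L , [] , f) =
      let j′ , q′ , L′ , f′ , u , seg , c = next-batch accepted f
      in (u , j′ , q′ , L′ , seg , f′) , next-crossing c
    continue (_ , j , q , L , (i ∷ seg) , f) = (_ , j , q , L , seg , f) , next-emit

    -- Shifted by one, as the automaton starts in `nil` and guesses the first batch in its first
    -- transition.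
    pending : ∀ i → Pending (suc i)
    pending zero =
      let j , q , L , f , u , seg , _ = next-batch accepted (first accepted)
      in u , j , q , L , seg , f
    pending (suc i) = proj₁ (continue (pending i))

    automaton-run : ℕ → Tree
    automaton-run zero    = nil
    automaton-run (suc i) = tree-of (pending i)

    automaton-step : ∀ i → Next (v i) (automaton-run i) (automaton-run (suc i))
    automaton-step zero    =
      let _ , _ , _ , _ , _ , _ , c = next-batch accepted (first accepted)
      in next-start-ω c
    automaton-step (suc i) = proj₂ (continue (pending i))

  pathsω⇔ : ∀ {v} → Pathω nil v ⇔ Acceptsω Ω v
  pathsω⇔ = mk⇔
    (λ { (r , e , steps) → ΩZ.Infinite.batches-accepted _ (Between steps) (between-start steps e)
                             (between-advance steps) })
    (λ acc → automaton-run acc , refl , automaton-step acc)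

proposition3 : (𝓡 : RewriteTheory) (L : Language (Rewriting.State 𝓡)) →
    L ⊆ᴸ executions 𝓡 → ∞-RecursivelyEnumerable 𝓡 L →
    Σ[ X ∈ Extension 𝓡 ]
    (Extension.Protecting X ×
    Σ[ M ∈ Strategies.StrategyModule (Extension.extendedTheory X) ]
    Σ[ α ∈ Semantics.Strat (Extension.extendedTheory X) M [] ]
    E 𝓡 X M α ≈ᴸ L)
proposition3 𝓡 L L⊆ re =
  X , protecting , M , α , strategy-language {L} L⊆ finite⇔ infinite⇔
  where
  open ∞-RecursivelyEnumerable re
  open Program acceptor ω-acceptor
  open HornExtension 𝓡 program using (X; protecting)
  open TraceStrategy 𝓡 program label letter nil using (M; α; strategy-language)
  open Automaton program label
  open Rewriting 𝓡 using (_≋_)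

  finite⇔ : ∀ w → Language.finite L w ⇔
    (∃[ v ] Path nil v × Pointwise (λ s a → s ≋ letter a) w v)
  finite⇔ w = mk⇔ to λ (v , p , ms) →
    Equivalence.from (finite-words w) (v , proj₂ (Equivalence.to paths⇔ p) , ms)
    where
    to : Language.finite L w → ∃[ v ] Path nil v × Pointwise (λ s a → s ≋ letter a) w v
    to x with Equivalence.to (finite-words w) x
    -- The empty word is no execution, so it is not in `L`.
    ... | [] , _ , [] = contradiction refl (proj₁ (proj₁ L⊆ _ x))
    ... | v@(_ ∷ _) , acc , ms = v , Equivalence.from paths⇔ ((λ ()) , acc) , ms

  infinite⇔ : ∀ w → Language.infinite L w ⇔ (∃[ v ] Pathω nil v × (∀ i → w i ≋ letter (v i)))
  infinite⇔ w = mk⇔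
    (λ x → let v , acc , ms = Equivalence.to (infinite-words w) x in
       v , Equivalence.from pathsω⇔ acc , ms)
    (λ (v , p , ms) → Equivalence.from (infinite-words w) (v , Equivalence.to pathsω⇔ p , ms))
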